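{- Let $s,t$ be integers, let $(U_n)_{n\ge 0}$ be the Lucas sequence and $(P_n)_{n\ge 1}$ the sequence of Lucas atoms associated with $(s,t)$. (i) If $2\nmid t$ and $2\mid s$ (i.e., $2\mid\Delta$ and $\rho(2,U)=2$), then \[ v_2(P_n)=\begin{cases} v_2(U_2) & \text{if } n=2,\\ 1 & \text{if } n=2^h,\ h\ge 2,\\ 0 & \text{otherwise.}\end{cases} \] (ii) If $2\nmid t$ and $2\nmid s$ (i.e., $2\nmid\Delta$ and $\rho(2,U)=3$), then \[ v_2(P_n)=\begin{cases} v_2(U_3) & \text{if } n=3,\\ v_2(U_6)-v_2(U_3) & \text{if } n=6,\\ 1 & \text{if } n=3\cdot 2^h,\ h\ge 2,\\ 0 & \text{otherwise.}\end{cases} \]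
   Context: Lucas sequence: for integers $s,t$, $U_0=0$, $U_1=1$, $U_n=sU_{n-1}+tU_{n-2}$ for $n\ge 2$. $\Delta=s^2+4t$ is the discriminant of its characteristic polynomial $X^2-sX-t$, and $\rho(2,U)$ is the rank of appearance of $2$ in $(U_m)_{m\ge 0}$, i.e. the minimum positive integer $k$ such that $2\mid U_k$. Lucas atoms: for $n\ge 1$ let $\Phi_n(\alpha,\beta)=\prod_{1\le j\le n,\ \gcd(j,n)=1}(\alpha-\omega^j\beta)$, with $\omega$ a primitive $n$-th root of unity (the homogenization of the $n$-th cyclotomic polynomial). Put $P_1(s,t)=1$, and for $n\ge 2$ let $P_n(s,t)\in\mathbb Z[s,t]$ be the polynomial with $P_n(\alpha+\beta,-\alpha\beta)=\Phi_n(\alpha,\beta)$ as polynomials in the variables $\alpha,\beta$. For integers $s,t$, $P_n$ denotes the integer value $P_n(s,t)$, for $n\ge 1$. $v_2$ denotes the $2$-adic valuation.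
   Formalization: In (i) the "i.e." is stated as an equivalence of 2∣s with (2∣Δ and ρ(2,U)=2) under 2∤t, since it fails for s=t=2; in (ii) the case n=6 is written v_2(P_6)+v_2(U_3)=v_2(U_6) with v_2(0)=∞, since the difference is undefined when U_3=0 (e.g. s=1, t=-1). -}

module Defs where

open import Level using (Level; suc; _⊔_)
open import Algebra.Bundles using (CommutativeRing)
open import Algebra.Bundles.Raw using (RawRing)
open import Algebra.Apartness.Bundles using (HeytingField; HeytingCommutativeRing)
import Algebra.Definitions.RawSemiring as RawSemiringOps
open import Data.Bool.Base using (if_then_else_)
open import Data.Integer.Base using (ℤ; +_; -[1+_]; ∣_∣; _+_; _*_; +-*-rawRing)
open import Data.Integer.Divisibility using (_∣_)
open import Data.List.Base using (List; []; _∷_; map; filter; foldr; applyUpTo)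
open import Data.Nat.Base as ℕ using (ℕ; zero; NonZero)
open import Data.Nat.Divisibility as ℕ using (_∣?_)
open import Data.Nat.GCD using (gcd)
import Data.Nat.Properties as ℕ
open import Data.Product.Base using (_×_)
open import Relation.Binary.PropositionalEquality using (_≡_)
open import Relation.Nullary using (¬_; does)
open import Relation.Nullary.Construct.Add.Supremum using (_⁺; ⊤⁺; [_])

private
  variable
    a b c ℓ ℓ₁ ℓ₂ : Level
    A : Set a

-- R[X]: a polynomial is the list of its coefficients, constant term first.
-- Trailing zeros are allowed, so equality is coefficientwise.
module _ (R : RawRing c ℓ) where
  private module R = RawRing R

  coeff : List R.Carrier → ℕ → R.Carrier
  coeff []      _         = R.0#
  coeff (x ∷ p) zero      = x
  coeff (x ∷ p) (ℕ.suc i) = coeff p i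

  addPoly : List R.Carrier → List R.Carrier → List R.Carrier
  addPoly []      q       = q
  addPoly (x ∷ p) []      = x ∷ p
  addPoly (x ∷ p) (y ∷ q) = (x R.+ y) ∷ addPoly p q

  mulPoly : List R.Carrier → List R.Carrier → List R.Carrier
  mulPoly []      q = []
  mulPoly (x ∷ p) q = addPoly (map (x R.*_) q) (R.0# ∷ mulPoly p q)

  Poly : RawRing c ℓ
  Poly = record
    { Carrier = List R.Carrier
    ; _≈_     = λ p q → ∀ i → coeff p i R.≈ coeff q i
    ; _+_     = addPoly
    ; _*_     = mulPoly
    ; -_      = map (R.-_)
    ; 0#      = []
    ; 1#      = R.1# ∷ []
    }

-- R[X,Y], encoded as R[X][Y].
Poly₂ : RawRing c ℓ → RawRing c ℓ
Poly₂ R = Poly (Poly R)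

ℤ[s,t] : RawRing _ _
ℤ[s,t] = Poly₂ +-*-rawRing

module _ (R : RawRing c ℓ) where
  private module R = RawRing R
  open RawSemiringOps R.rawSemiring using () renaming (_×_ to _·_)

  fromℤ : ℤ → R.Carrier
  fromℤ (+ n)    = n · R.1#
  fromℤ -[1+ n ] = R.- (ℕ.suc n · R.1#)

  horner : (A → R.Carrier) → R.Carrier → List A → R.Carrier
  horner f x []      = R.0#
  horner f x (k ∷ p) = f k R.+ x R.* horner f x p

  -- The value P(x,y) in R of P ∈ ℤ[s,t]; the inner variable is s.
  eval : RawRing.Carrier ℤ[s,t] → R.Carrier → R.Carrier → R.Carrier
  eval P x y = horner (horner fromℤ x) y P

module _ (R : RawRing c ℓ) where
  private
    module R  = RawRing R
    module R₂ = RawRing (Poly₂ R)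
  open RawSemiringOps R.rawSemiring using (_^_)

  const₂ : R.Carrier → R₂.Carrier
  const₂ x = (x ∷ []) ∷ []

  α β : R₂.Carrier
  α = (R.0# ∷ R.1# ∷ []) ∷ []
  β = [] ∷ (R.1# ∷ []) ∷ []

  -- ∏ (α - ωʲβ) over 1 ≤ j ≤ n with gcd(j,n) = 1
  Φ : R.Carrier → ℕ → R₂.Carrier
  Φ ω n = foldr R₂._*_ R₂.1#
    (map (λ j → α R₂.+ (R₂.- (const₂ (ω ^ j) R₂.* β)))
         (filter (λ j → gcd j n ℕ.≟ 1) (applyUpTo ℕ.suc n)))

-- The roots of unity live in an arbitrary field of characteristic zero which
-- contains a primitive n-th root of unity for every n ≥ 1, such as ℂ. "Field"
-- is the constructive notion: x # y means that x - y is invertible.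
record FieldWithRootsOfUnity c ℓ₁ ℓ₂ : Set (suc (c ⊔ ℓ₁ ⊔ ℓ₂)) where
  field
    heytingField : HeytingField c ℓ₁ ℓ₂

  open HeytingField heytingField public
    using (Carrier; _≈_; _#_; 0#; 1#; heytingCommutativeRing)

  rawRing : RawRing c ℓ₁
  rawRing = CommutativeRing.rawRing
    (HeytingCommutativeRing.commutativeRing heytingCommutativeRing)

  open RawSemiringOps (RawRing.rawSemiring rawRing) public
    using (_^_) renaming (_×_ to _·_)

  IsPrimitiveRoot : ℕ → Carrier → Set (ℓ₁ ⊔ ℓ₂)
  IsPrimitiveRoot n ω = (ω ^ n ≈ 1#) × (∀ j → 0 ℕ.< j → j ℕ.< n → (ω ^ j) # 1#)

  field
    characteristicZero : ∀ n → .{{NonZero n}} → (n · 1#) # 0#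
    ζ                  : ℕ → Carrier
    ζ-primitive        : ∀ n → .{{NonZero n}} → IsPrimitiveRoot n (ζ n)

-- (Pₙ) is the sequence of Lucas atoms, as polynomials in ℤ[s,t]: P₁ = 1, and
-- Pₙ(α+β, -αβ) = Φₙ(α,β) in K[α,β] for n ≥ 2. The term P 0 is irrelevant.
IsLucasAtoms : FieldWithRootsOfUnity c ℓ₁ ℓ₂ →
               (ℕ → RawRing.Carrier ℤ[s,t]) → Set ℓ₁
IsLucasAtoms K P =
    (P 1 ≈ℤ[s,t] RawRing.1# ℤ[s,t])
  × (∀ n → n ℕ.≥ 2 →
       eval (Poly₂ R) (P n) (α R K₂.+ β R) (K₂.- (α R K₂.* β R)) K₂.≈ Φ R (ζ n) n)
  where
    open FieldWithRootsOfUnity K using (ζ) renaming (rawRing to R)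
    module K₂ = RawRing (Poly₂ R)
    open RawRing ℤ[s,t] using () renaming (_≈_ to _≈ℤ[s,t]_)

U : ℤ → ℤ → ℕ → ℤ
U s t 0                 = + 0
U s t 1                 = + 1
U s t (ℕ.suc (ℕ.suc n)) = s * U s t (ℕ.suc n) + t * U s t n

Δ : ℤ → ℤ → ℤ
Δ s t = s * s + (+ 4) * t

-- k is the rank of appearance of m in the sequence u.
IsRank : ℤ → (ℕ → ℤ) → ℕ → Set
IsRank m u k = (0 ℕ.< k) × (m ∣ u k) × (∀ j → 0 ℕ.< j → m ∣ u j → k ℕ.≤ j)

-- The largest e ≤ k with 2ᵉ ∣ n.
greatestExponent : ℕ → ℕ → ℕ
greatestExponent n zero      = zero
greatestExponent n (ℕ.suc k) =
  if does ((2 ℕ.^ ℕ.suc k) ∣? n) then ℕ.suc k else greatestExponent n k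

-- 2ᵉ ∣ n with n ≠ 0 forces e ≤ n, so n bounds the search.
v₂ℕ : ℕ → ℕ ⁺
v₂ℕ zero        = ⊤⁺
v₂ℕ n@(ℕ.suc _) = [ greatestExponent n n ]

v₂ : ℤ → ℕ ⁺
v₂ x = v₂ℕ ∣ x ∣

-- A difference v₂(x) - v₂(y) is expressed additively with _+⁺_, since it is
-- undefined when x = y = 0 (this occurs: U₃ = U₆ = 0 for s = 1, t = -1).
infixl 6 _+⁺_
_+⁺_ : ℕ ⁺ → ℕ ⁺ → ℕ ⁺
[ m ] +⁺ [ n ] = [ m ℕ.+ n ]
_     +⁺ _     = ⊤⁺

{-# OPTIONS --safe #-}
module Submission where

-- With d(k) = n / gcd (k , n), the numbers r(k) = ζ(d(k)) ^ (k / gcd (k , n)), 1 ≤ k ≤ n, are n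
-- mutually apart n-th roots of unity. For n = m q those with q ∤ k are the roots of
-- (xⁿ - yⁿ) / (xᵐ - yᵐ), so grouping the factors x - r(k) y by d(k) writes this quotient as the
-- product of Φ_d(x,y) over the divisors d of n not dividing m. At the roots x, y of X² - sX - t,
-- taken in K[X]/(X² - sX - t), both sides are integers: U_n / U_m, read as the q-th term of the
-- Lucas sequence with roots xᵐ and yᵐ (so that U_m = 0 is harmless), is the product of the P_d.
-- If it is odd for some proper divisor m of n then P_n is odd; this settles all n except 2^h
-- (h ≥ 1) in case (i) and 3·2^h in case (ii). For even such n take m = n/2: all factors P_d
-- other than P_n are odd, and the quotient is V_m = xᵐ + yᵐ. If m is even as well, then
-- V_m = V_{m/2}² - 2(-t)^{m/2} with V_{m/2} even, so its valuation is 1.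

open import Defs
open import Algebra.Apartness.Bundles using (HeytingField; HeytingCommutativeRing)
open import Algebra.Bundles using (CommutativeMonoid; CommutativeRing)
open import Algebra.Bundles.Raw using (RawRing)
import Algebra.Definitions.RawSemiring as RawSemiringOps
open import Algebra.Morphism.Construct.Identity using (isRingHomomorphism)
open import Algebra.Morphism.Structures using (IsRingHomomorphism)
import Algebra.Properties.AbelianGroup as AbelianGroupProperties
import Algebra.Properties.CommutativeMonoid.Sum as MonoidSum
import Algebra.Properties.CommutativeSemigroup as CommutativeSemigroupProperties
import Algebra.Properties.CommutativeSemiring.Exp as CommutativeSemiringExp
import Algebra.Properties.Ring as RingProperties
import Algebra.Properties.Semiring.Exp as SemiringExp
import Algebra.Properties.Semiring.Mult as SemiringMult
import Algebra.Solver.Ring as RingSolver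
open import Algebra.Solver.Ring.AlmostCommutativeRing
  using (fromCommutativeRing; _-Raw-AlmostCommutative⟶_; Induced-equivalence)
open import Data.Bool.Base using (true; false; if_then_else_)
open import Data.Fin.Base using (toℕ)
import Data.Fin.Properties as Fin
open import Data.Integer.Base as ℤ using (ℤ; +_; -[1+_]; +-*-rawRing; _⊖_)
import Data.Integer.DivMod as ℤ
import Data.Integer.Divisibility as ℤ
import Data.Integer.Divisibility.Signed as Signed
import Data.Integer.Properties as ℤ
open import Data.Integer.Tactic.RingSolver using (solve-∀)
open import Data.List.Base using (List; []; _∷_; _++_; map; filter; foldr; applyUpTo; length; replicate)
import Data.List.Properties as List
open import Data.List.Relation.Unary.All as All using (All; []; _∷_)
import Data.List.Relation.Unary.All.Properties as All
open import Data.List.Relation.Unary.AllPairs using (AllPairs; []; _∷_)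
import Data.List.Relation.Unary.AllPairs.Properties as AllPairs
import Data.Maybe.Base as Maybe
open import Data.Nat.Base as ℕ using (ℕ; zero; suc; NonZero; _<_; z≤n; s≤s; z<s; s<s)
open import Data.Nat.Coprimality as Coprimality using (Coprime; GCD≡1⇒coprime; coprime-divisor)
open import Data.Nat.Divisibility as ℕ using (_∤_; _∣?_; divides)
open import Data.Nat.DivMod using (_%_; _/_; m≡m%n+[m/n]*n; m%n<n)
open import Data.Nat.GCD as GCD using (gcd; gcd[m,n]∣m; gcd[m,n]∣n; gcd-greatest)
open import Data.Nat.Induction using (<-rec)
open import Data.Nat.Primality using (euclidsLemma; prime[2])
import Data.Nat.Properties as ℕ
open import Data.Product.Base using (_×_; _,_; ∃-syntax; proj₁; proj₂)
open import Data.Sum.Base using (inj₁; inj₂; [_,_]′)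
open import Function.Base using (_∘_; id)
open import Function.Bundles using (_⇔_; mk⇔)
open import Level using (Level; _⊔_)
import Relation.Binary.PropositionalEquality as ≡
open import Relation.Binary.PropositionalEquality using (_≡_; _≢_)
import Relation.Binary.Reasoning.Setoid as SetoidReasoning
open import Relation.Binary.Definitions using (WeaklyDecidable)
open import Relation.Nullary using (¬_; ¬?; Dec; does; yes; no; contradiction)
open import Relation.Nullary.Construct.Add.Supremum using (⊤⁺; [_])
open import Relation.Nullary.Decidable using (dec⇒maybe; _×-dec_)
open import Relation.Unary using (Decidable)

-- The obstacles are constructive. Equality in `K` need not be decidable, and apartness means that a
-- difference is invertible. A further root survives the division by a linear factor only if its
-- difference to the root split off can be cancelled, so all roots have to be mutually apart rather
-- than just unequal. The ζ(d) are chosen independently for different d. Powers of ζ(n) alone would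
-- first have to be matched with the powers of ζ(d) in the definition of Φ_d; letting each k use its
-- own ζ(d(k)) avoids that, at the price of comparing powers of different ζ(d). The quadratic
-- extension provides the roots of X² - sX - t without a square root of Δ, but it may have zero
-- divisors. Hence everything that needs inverses takes place in `K`: the factorisation concerns
-- binary forms with coefficients in `K`, and only the resulting identity is evaluated in the
-- extension. No quotient is formed there, and the identity returns to the integers because they
-- embed in the extension, `K` having characteristic zero.

private
  variable
    a p p′ : Level
    c ℓ c′ ℓ′ c″ ℓ″ ℓ₁ ℓ₂ : Level

-- Ring homomorphisms and the canonical map from the integers.

module _ {R : RawRing c ℓ} {S : RawRing c′ ℓ′} where
  private
    module R = RawRing R
    module S = RawRing S

  mkIsRingHomomorphism : {f : R.Carrier → S.Carrier} →
    (∀ {x y} → x R.≈ y → f x S.≈ f y) →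
    (∀ x y → f (x R.+ y) S.≈ f x S.+ f y) →
    (∀ x y → f (x R.* y) S.≈ f x S.* f y) →
    (∀ x → f (R.- x) S.≈ S.- f x) →
    f R.0# S.≈ S.0# → f R.1# S.≈ S.1# → IsRingHomomorphism R S f
  mkIsRingHomomorphism cong +-homo *-homo -‿homo 0#-homo 1#-homo = record
    { isSemiringHomomorphism = record
      { isNearSemiringHomomorphism = record
        { +-isMonoidHomomorphism = record
          { isMagmaHomomorphism = record
            { isRelHomomorphism = record { cong = cong } ; homo = +-homo }
          ; ε-homo = 0#-homo }
        ; *-homo = *-homo }
      ; 1#-homo = 1#-homo }
    ; -‿homo = -‿homo }

module _ (R : CommutativeRing c ℓ) where
  open CommutativeRing R
  open RingProperties ring using (-‿distribˡ-*; -0#≈0#; -‿involutive)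
  open AbelianGroupProperties +-abelianGroup using (⁻¹-∙-comm)
  open SemiringMult semiring using (×-homo-+; ×1-homo-*) renaming (_×_ to _·_)
  open SetoidReasoning setoid

  private
    ι : ℤ → Carrier
    ι = fromℤ rawRing

    ι-⊖ : ∀ m n → ι (m ⊖ n) ≈ m · 1# - n · 1#
    ι-⊖ m       zero    = sym (trans (+-congˡ -0#≈0#) (+-identityʳ _))
    ι-⊖ zero    (suc n) = sym (+-identityˡ _)
    ι-⊖ (suc m) (suc n) = begin
      ι (suc m ⊖ suc n)                  ≡⟨ ≡.cong ι (ℤ.[1+m]⊖[1+n]≡m⊖n m n) ⟩
      ι (m ⊖ n)                          ≈⟨ ι-⊖ m n ⟩
      m · 1# - n · 1#                    ≈⟨ +-congˡ (+-identityˡ _) ⟨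
      m · 1# + (0# - n · 1#)             ≈⟨ +-congˡ (+-congʳ (-‿inverseʳ 1#)) ⟨
      m · 1# + (1# - 1# - n · 1#)        ≈⟨ +-congˡ (+-assoc _ _ _) ⟩
      m · 1# + (1# + (- 1# - n · 1#))    ≈⟨ +-assoc _ _ _ ⟨
      m · 1# + 1# + (- 1# - n · 1#)      ≈⟨ +-cong (+-comm _ _) (⁻¹-∙-comm _ _) ⟩
      suc m · 1# - suc n · 1#            ∎

    ι-+ : ∀ i j → ι (i ℤ.+ j) ≈ ι i + ι j
    ι-+ (+ m)    (+ n)    = ×-homo-+ 1# m n
    ι-+ (+ m)    -[1+ n ] = ι-⊖ m (suc n)
    ι-+ -[1+ m ] (+ n)    = trans (ι-⊖ n (suc m)) (+-comm _ _)
    ι-+ -[1+ m ] -[1+ n ] = begin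
      - (suc (suc (m ℕ.+ n)) · 1#)   ≡⟨ ≡.cong (λ k → - (suc k · 1#)) (≡.sym (ℕ.+-suc m n)) ⟩
      - ((suc m ℕ.+ suc n) · 1#)     ≈⟨ -‿cong (×-homo-+ 1# (suc m) (suc n)) ⟩
      - (suc m · 1# + suc n · 1#)    ≈⟨ ⁻¹-∙-comm _ _ ⟨
      - (suc m · 1#) - suc n · 1#    ∎

    ι-neg : ∀ i → ι (ℤ.- i) ≈ - ι i
    ι-neg (+ zero)  = sym -0#≈0#
    ι-neg (+ suc n) = refl
    ι-neg -[1+ n ]  = sym (-‿involutive _)

    ι-*⁺ : ∀ m j → ι (+ m ℤ.* j) ≈ ι (+ m) * ι j
    ι-*⁺ m (+ n) = trans (reflexive (≡.cong ι (≡.sym (ℤ.pos-* m n)))) (×1-homo-* m n)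
    ι-*⁺ m -[1+ n ] = begin
      ι (+ m ℤ.* -[1+ n ])               ≡⟨ ≡.cong ι (ℤ.neg-distribʳ-* (+ m) (+ suc n)) ⟨
      ι (ℤ.- (+ m ℤ.* + suc n))          ≈⟨ ι-neg (+ m ℤ.* + suc n) ⟩
      - ι (+ m ℤ.* + suc n)              ≈⟨ -‿cong (ι-*⁺ m (+ suc n)) ⟩
      - (ι (+ m) * ι (+ suc n))          ≈⟨ RingProperties.-‿distribʳ-* ring _ _ ⟩
      ι (+ m) * - ι (+ suc n)            ∎

    ι-* : ∀ i j → ι (i ℤ.* j) ≈ ι i * ι j
    ι-* (+ m)    j = ι-*⁺ m j
    ι-* -[1+ m ] j = begin
      ι (-[1+ m ] ℤ.* j)            ≡⟨ ≡.cong ι (ℤ.neg-distribˡ-* (+ suc m) j) ⟨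
      ι (ℤ.- (+ suc m ℤ.* j))       ≈⟨ ι-neg (+ suc m ℤ.* j) ⟩
      - ι (+ suc m ℤ.* j)           ≈⟨ -‿cong (ι-*⁺ (suc m) j) ⟩
      - (ι (+ suc m) * ι j)         ≈⟨ -‿distribˡ-* _ _ ⟩
      - ι (+ suc m) * ι j           ∎

  fromℤ-isRingHomomorphism : IsRingHomomorphism +-*-rawRing rawRing (fromℤ rawRing)
  fromℤ-isRingHomomorphism = mkIsRingHomomorphism
    (λ { ≡.refl → refl }) ι-+ ι-* ι-neg refl (+-identityʳ 1#)

  private
    fromℤ-morphism : +-*-rawRing -Raw-AlmostCommutative⟶ fromCommutativeRing R
    fromℤ-morphism = record { ⟦_⟧ = ι ; +-homo = ι-+ ; *-homo = ι-* ; -‿homo = ι-neg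
                            ; 0-homo = refl ; 1-homo = +-identityʳ 1# }

    _coeff≟_ : WeaklyDecidable (Induced-equivalence fromℤ-morphism)
    i coeff≟ j = Maybe.map (λ { ≡.refl → refl }) (dec⇒maybe (i ℤ.≟ j))

  -- The solver normalises with integer coefficients, whose equality is decidable; equality in `R`
  -- need not be.
  module ℤSolver = RingSolver +-*-rawRing (fromCommutativeRing R) fromℤ-morphism _coeff≟_

-- Evaluation of polynomials.

module _ {R : RawRing c ℓ} (S : CommutativeRing c′ ℓ′)
         {f : RawRing.Carrier R → CommutativeRing.Carrier S}
         (f-hom : IsRingHomomorphism R (CommutativeRing.rawRing S) f) where
  private module R = RawRing R
  open CommutativeRing S
  open IsRingHomomorphism f-hom
  open SetoidReasoning setoid
  open RingProperties ring using (-0#≈0#)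
  open ℤSolver S using (solve; _:=_; _:+_; _:*_; :-_)

  module _ (x : Carrier) where
    private
      ev : List R.Carrier → Carrier
      ev = horner rawRing f x

      -- Coefficientwise equal lists can differ by trailing zeros, so once one list is exhausted,
      -- what is left of the other must be shown to evaluate to zero.
      ev-cong : ∀ p q → (∀ i → coeff R p i R.≈ coeff R q i) → ev p ≈ ev q
      ev-cong []      []      _   = refl
      ev-cong (k ∷ p) []      p≈q = begin
        f k + x * ev p   ≈⟨ +-cong (⟦⟧-cong (p≈q 0)) (*-congˡ (ev-cong p [] (λ i → p≈q (suc i)))) ⟩
        f R.0# + x * 0#  ≈⟨ +-cong 0#-homo (zeroʳ x) ⟩
        0# + 0#          ≈⟨ +-identityˡ _ ⟩
        0#               ∎
      ev-cong []      (l ∷ q) p≈q = begin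
        0#               ≈⟨ +-identityˡ _ ⟨
        0# + 0#          ≈⟨ +-cong 0#-homo (zeroʳ x) ⟨
        f R.0# + x * 0#  ≈⟨ +-cong (⟦⟧-cong (p≈q 0)) (*-congˡ (ev-cong [] q (λ i → p≈q (suc i)))) ⟩
        f l + x * ev q   ∎
      ev-cong (k ∷ p) (l ∷ q) p≈q =
        +-cong (⟦⟧-cong (p≈q 0)) (*-congˡ (ev-cong p q (λ i → p≈q (suc i))))

      ev-+ : ∀ p q → ev (addPoly R p q) ≈ ev p + ev q
      ev-+ []      q       = sym (+-identityˡ _)
      ev-+ (k ∷ p) []      = sym (+-identityʳ _)
      ev-+ (k ∷ p) (l ∷ q) = begin
        f (k R.+ l) + x * ev (addPoly R p q)   ≈⟨ +-cong (+-homo k l) (*-congˡ (ev-+ p q)) ⟩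
        f k + f l + x * (ev p + ev q)          ≈⟨ solve 5 (λ a b x p q → a :+ b :+ x :* (p :+ q)
                                                    := (a :+ x :* p) :+ (b :+ x :* q)) refl
                                                    (f k) (f l) x (ev p) (ev q) ⟩
        f k + x * ev p + (f l + x * ev q)      ∎

      ev-scale : ∀ k q → ev (map (k R.*_) q) ≈ f k * ev q
      ev-scale k []      = sym (zeroʳ _)
      ev-scale k (l ∷ q) = begin
        f (k R.* l) + x * ev (map (k R.*_) q)  ≈⟨ +-cong (*-homo k l) (*-congˡ (ev-scale k q)) ⟩
        f k * f l + x * (f k * ev q)           ≈⟨ solve 4 (λ k l x q → k :* l :+ x :* (k :* q)
                                                    := k :* (l :+ x :* q)) refl
                                                    (f k) (f l) x (ev q) ⟩
        f k * (f l + x * ev q)                 ∎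

      ev-* : ∀ p q → ev (mulPoly R p q) ≈ ev p * ev q
      ev-* []      q = sym (zeroˡ _)
      ev-* (k ∷ p) q = begin
        ev (addPoly R (map (k R.*_) q) (R.0# ∷ mulPoly R p q))
          ≈⟨ ev-+ (map (k R.*_) q) _ ⟩
        ev (map (k R.*_) q) + (f R.0# + x * ev (mulPoly R p q))
          ≈⟨ +-cong (ev-scale k q) (+-cong 0#-homo (*-congˡ (ev-* p q))) ⟩
        f k * ev q + (0# + x * (ev p * ev q))
          ≈⟨ +-congˡ (+-identityˡ _) ⟩
        f k * ev q + x * (ev p * ev q)
          ≈⟨ solve 4 (λ k x p q → k :* q :+ x :* (p :* q) := (k :+ x :* p) :* q) refl
               (f k) x (ev p) (ev q) ⟩
        (f k + x * ev p) * ev q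
          ∎

      ev-neg : ∀ p → ev (map R.-_ p) ≈ - ev p
      ev-neg []      = sym -0#≈0#
      ev-neg (k ∷ p) = begin
        f (R.- k) + x * ev (map R.-_ p)  ≈⟨ +-cong (-‿homo k) (*-congˡ (ev-neg p)) ⟩
        - f k + x * - ev p               ≈⟨ solve 3 (λ k x p → :- k :+ x :* (:- p)
                                              := :- (k :+ x :* p)) refl (f k) x (ev p) ⟩
        - (f k + x * ev p)               ∎

    -- Since `R` is a raw ring, it may itself be a polynomial ring. The lemma can therefore be
    -- iterated, which gives evaluation in two variables.
    horner-isRingHomomorphism :
      IsRingHomomorphism (Poly R) rawRing (horner rawRing f x)
    horner-isRingHomomorphism = mkIsRingHomomorphism (λ {p} {q} → ev-cong p q) ev-+ ev-* ev-neg refl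
      (trans (+-cong 1#-homo (zeroʳ x)) (+-identityʳ 1#))

  open RawSemiringOps R.rawSemiring using () renaming (_×_ to _·ᴿ_)
  open RawSemiringOps (RawRing.rawSemiring rawRing) using () renaming (_×_ to _·ˢ_)

  hom-· : ∀ n → f (n ·ᴿ R.1#) ≈ n ·ˢ 1#
  hom-· zero    = 0#-homo
  hom-· (suc n) = trans (+-homo _ _) (+-cong 1#-homo (hom-· n))

  hom-fromℤ : ∀ i → f (fromℤ R i) ≈ fromℤ rawRing i
  hom-fromℤ (+ n)    = hom-· n
  hom-fromℤ -[1+ n ] = trans (-‿homo _) (-‿cong (hom-· (suc n)))

  private
    hom-horner : {A : Set c″} {g : A → R.Carrier} {h : A → Carrier} →
      (∀ a → f (g a) ≈ h a) → ∀ {x y} → f x ≈ y →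
      ∀ p → f (horner R g x p) ≈ horner rawRing h y p
    hom-horner fg≈h fx≈y []      = 0#-homo
    hom-horner fg≈h fx≈y (a ∷ p) = trans (+-homo _ _) (+-cong (fg≈h a)
      (trans (*-homo _ _) (*-cong fx≈y (hom-horner fg≈h fx≈y p))))

  -- Both the map from the integers and the substitution for α and β in K[α,β] land in the quadratic
  -- extension. Applied to each of them, this makes the integer value of an atom comparable with the
  -- image of Φ_d.
  hom-eval : ∀ P {x y x′ y′} → f x ≈ x′ → f y ≈ y′ →
             f (eval R P x y) ≈ eval rawRing P x′ y′
  hom-eval P fx≈x′ fy≈y′ = hom-horner (hom-horner hom-fromℤ fx≈x′) fy≈y′ P

-- Finite products with conditions on the index.

module _ (M : CommutativeMonoid c ℓ) where
  open CommutativeMonoid M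
  open MonoidSum M using (sum; sum-cong-≋; ∑-comm; sum-replicate-zero)
  open SetoidReasoning setoid

  -- Restricted products are written as products over the full range, with the neutral element at
  -- the excluded indices. Exchanging two products is then possible although the condition involves
  -- both indices.
  when : {P : Set p} → Dec P → Carrier → Carrier
  when P? x = if does P? then x else ε

  when-true : {P : Set p} (P? : Dec P) {x : Carrier} → P → when P? x ≈ x
  when-true (yes _)  _  = refl
  when-true (no ¬Px) Px = contradiction Px ¬Px

  when-ε : {P : Set p} (P? : Dec P) {x : Carrier} → (P → x ≈ ε) → when P? x ≈ ε
  when-ε (yes Px) x≈ε = x≈ε Px
  when-ε (no _)   _   = refl

  when-false : {P : Set p} (P? : Dec P) {x : Carrier} → ¬ P → when P? x ≈ ε
  when-false P? ¬Px = when-ε P? (λ Px → contradiction Px ¬Px)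

  when-⇔ : {P : Set p} {Q : Set p′} (P? : Dec P) (Q? : Dec Q) {x y : Carrier} →
           (P → Q) → (Q → P) → (P → x ≈ y) → when P? x ≈ when Q? y
  when-⇔ (yes Px) Q? P⇒Q _ x≈y = trans (x≈y Px) (sym (when-true Q? (P⇒Q Px)))
  when-⇔ (no ¬Px) Q? _ Q⇒P _   = sym (when-false Q? (¬Px ∘ Q⇒P))

  ∏ : ℕ → (ℕ → Carrier) → Carrier
  ∏ n f = sum {n} (f ∘ toℕ)

  ∏-cong : ∀ n {f g : ℕ → Carrier} → (∀ i → i < n → f i ≈ g i) → ∏ n f ≈ ∏ n g
  ∏-cong n f≈g = sum-cong-≋ {n} (λ i → f≈g (toℕ i) (Fin.toℕ<n i))

  ∏-ε : ∀ n {f : ℕ → Carrier} → (∀ i → i < n → f i ≈ ε) → ∏ n f ≈ ε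
  ∏-ε n f≈ε = trans (∏-cong n f≈ε) (sum-replicate-zero n)

  ∏-comm : ∀ m n (f : ℕ → ℕ → Carrier) →
           ∏ m (λ i → ∏ n (f i)) ≈ ∏ n (λ j → ∏ m (λ i → f i j))
  ∏-comm m n f = ∑-comm {m} {n} (λ i j → f (toℕ i) (toℕ j))

  ∏-+ : ∀ m n (f : ℕ → Carrier) → ∏ (m ℕ.+ n) f ≈ ∏ m f ∙ ∏ n (λ i → f (m ℕ.+ i))
  ∏-+ zero    n f = sym (identityˡ _)
  ∏-+ (suc m) n f = trans (∙-congˡ (∏-+ m n (f ∘ suc))) (sym (assoc _ _ _))

  ∏-last : ∀ n (f : ℕ → Carrier) → ∏ (suc n) f ≈ ∏ n f ∙ f n
  ∏-last zero    f = trans (identityʳ _) (sym (identityˡ _))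
  ∏-last (suc n) f = trans (∙-congˡ (∏-last n (f ∘ suc))) (sym (assoc _ _ _))

  ∏-single : ∀ {n i} {f : ℕ → Carrier} → i < n → (∀ j → j ≢ i → f j ≈ ε) → ∏ n f ≈ f i
  ∏-single {suc n} {zero}  {f} z<s f≈ε =
    trans (∙-congˡ (∏-ε n (λ i _ → f≈ε (suc i) λ ()))) (identityʳ _)
  ∏-single {suc n} {suc i} {f} (s<s i<n) f≈ε =
    trans (∙-cong (f≈ε 0 λ ()) (∏-single i<n (λ j j≢i → f≈ε (suc j) (j≢i ∘ ℕ.suc-injective))))
          (identityˡ _)

  -- The numbers from 1 to dg form `d` blocks of length `g`, and only the last number of each block
  -- is a multiple of `g`.
  ∏-multiples : ∀ g d .{{_ : ℕ.NonZero g}} (f : ℕ → Carrier) → (∀ k → g ∤ k → f k ≈ ε) →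
                ∏ (d ℕ.* g) (f ∘ suc) ≈ ∏ d (λ j → f (suc j ℕ.* g))
  ∏-multiples g@(suc g′) zero    f f≈ε = refl
  ∏-multiples g@(suc g′) (suc d) f f≈ε = begin
    ∏ (g ℕ.+ d ℕ.* g) (f ∘ suc)
      ≈⟨ ∏-+ g (d ℕ.* g) (f ∘ suc) ⟩
    ∏ g (f ∘ suc) ∙ ∏ (d ℕ.* g) (λ i → f (suc (g ℕ.+ i)))
      ≈⟨ ∙-cong (∏-last g′ (f ∘ suc)) (∏-cong (d ℕ.* g) (λ i _ → reflexive (≡.cong f (≡.sym (ℕ.+-suc g i))))) ⟩
    (∏ g′ (f ∘ suc) ∙ f g) ∙ ∏ (d ℕ.* g) (λ i → f (g ℕ.+ suc i))
      ≈⟨ ∙-cong (trans (∙-congʳ (∏-ε g′ (λ i i<g′ → f≈ε (suc i) (ℕ.>⇒∤ (s<s i<g′))))) (identityˡ _))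
                (∏-multiples g d (λ k → f (g ℕ.+ k))
                  (λ k g∤k → f≈ε (g ℕ.+ k) (λ g∣g+k → g∤k (ℕ.∣m+n∣m⇒∣n g∣g+k ℕ.∣-refl)))) ⟩
    f g ∙ ∏ d (λ j → f (suc (suc j) ℕ.* g))
      ≡⟨ ≡.cong (λ k → f k ∙ ∏ d (λ j → f (suc (suc j) ℕ.* g))) (ℕ.*-identityˡ g) ⟨
    f (1 ℕ.* g) ∙ ∏ d (λ j → f (suc (suc j) ℕ.* g))
      ∎

  foldr-filter : {A : Set a} {P : A → Set p} (P? : Decidable P) (f : A → Carrier) (h : ℕ → A) →
    ∀ n → foldr _∙_ ε (map f (filter P? (applyUpTo h n))) ≈ ∏ n (λ i → when (P? (h i)) (f (h i)))
  foldr-filter P? f h zero    = refl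
  foldr-filter P? f h (suc n) with does (P? (h 0))
  ... | true  = ∙-congˡ (foldr-filter P? f (h ∘ suc) n)
  ... | false = trans (foldr-filter P? f (h ∘ suc) n) (sym (identityˡ _))

-- Units and geometric sums.

module _ (R : CommutativeRing c ℓ) where
  open CommutativeRing R
  open SetoidReasoning setoid
  open ℤSolver R using (solve; _:=_; _:+_; _:*_; _:-_; :-_)

  -- u is a left inverse, hence by commutativity an inverse.
  IsUnit : Carrier → Set (c ⊔ ℓ)
  IsUnit x = ∃[ u ] u * x ≈ 1#

  isUnit-cong : ∀ {x y} → x ≈ y → IsUnit x → IsUnit y
  isUnit-cong x≈y (u , ux≈1) = u , trans (*-congˡ (sym x≈y)) ux≈1

  isUnit-* : ∀ {x y} → IsUnit x → IsUnit y → IsUnit (x * y)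
  isUnit-* {x} {y} (u , ux≈1) (v , vy≈1) = u * v , (begin
    u * v * (x * y)    ≈⟨ solve 4 (λ u v x y → u :* v :* (x :* y) := u :* x :* (v :* y)) refl u v x y ⟩
    u * x * (v * y)    ≈⟨ *-cong ux≈1 vy≈1 ⟩
    1# * 1#            ≈⟨ *-identityˡ 1# ⟩
    1#                 ∎)

  isUnit-*⁻ˡ : ∀ {x y} → IsUnit (x * y) → IsUnit x
  isUnit-*⁻ˡ {x} {y} (u , uxy≈1) = u * y , (begin
    u * y * x      ≈⟨ solve 3 (λ u x y → u :* y :* x := u :* (x :* y)) refl u x y ⟩
    u * (x * y)    ≈⟨ uxy≈1 ⟩
    1#             ∎)

  isUnit-neg : ∀ {x} → IsUnit x → IsUnit (- x)
  isUnit-neg {x} (u , ux≈1) = - u ,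
    trans (solve 2 (λ u x → :- u :* :- x := u :* x) refl u x) ux≈1

  isUnit-cancel : ∀ {x y} → IsUnit x → x * y ≈ 0# → y ≈ 0#
  isUnit-cancel {x} {y} (u , ux≈1) xy≈0 = begin
    y              ≈⟨ *-identityˡ y ⟨
    1# * y         ≈⟨ *-congʳ ux≈1 ⟨
    u * x * y      ≈⟨ *-assoc u x y ⟩
    u * (x * y)    ≈⟨ *-congˡ xy≈0 ⟩
    u * 0#         ≈⟨ zeroʳ u ⟩
    0#             ∎

  open SemiringExp semiring using (_^_; ^-congˡ)

  1^n≈1 : ∀ n → 1# ^ n ≈ 1#
  1^n≈1 zero    = refl
  1^n≈1 (suc n) = trans (*-identityˡ _) (1^n≈1 n)

  -- The sum of the monomials xⁱ yʲ with i + j = n - 1. It is the quotient of xⁿ - yⁿ by x - y, and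
  -- it makes sense also when x - y is not invertible.
  geometric : ℕ → Carrier → Carrier → Carrier
  geometric zero    x y = 0#
  geometric (suc n) x y = x ^ n + y * geometric n x y

  geometric-cong : ∀ n {x x′ y y′} → x ≈ x′ → y ≈ y′ → geometric n x y ≈ geometric n x′ y′
  geometric-cong zero    _    _    = refl
  geometric-cong (suc n) x≈x′ y≈y′ =
    +-cong (^-congˡ n x≈x′) (*-cong y≈y′ (geometric-cong n x≈x′ y≈y′))

  telescope : ∀ n x y → (x - y) * geometric n x y ≈ x ^ n - y ^ n
  telescope zero    x y = trans (zeroʳ _) (sym (-‿inverseʳ 1#))
  telescope (suc n) x y = begin
    (x - y) * (x ^ n + y * geometric n x y)
      ≈⟨ solve 4 (λ x y p g → (x :- y) :* (p :+ y :* g) := (x :- y) :* p :+ y :* ((x :- y) :* g))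
           refl x y (x ^ n) (geometric n x y) ⟩
    (x - y) * x ^ n + y * ((x - y) * geometric n x y)
      ≈⟨ +-congˡ (*-congˡ (telescope n x y)) ⟩
    (x - y) * x ^ n + y * (x ^ n - y ^ n)
      ≈⟨ solve 4 (λ x y p q → (x :- y) :* p :+ y :* (p :- q) := x :* p :- y :* q)
           refl x y (x ^ n) (y ^ n) ⟩
    x * x ^ n - y * y ^ n
      ∎

  geometric-recurrence : ∀ n x y →
    geometric (suc (suc n)) x y ≈ (x + y) * geometric (suc n) x y - x * y * geometric n x y
  geometric-recurrence n x y =
    solve 4 (λ x y p g → x :* p :+ y :* (p :+ y :* g) := (x :+ y) :* (p :+ y :* g) :- x :* y :* g)
      refl x y (x ^ n) (geometric n x y)

-- Binary forms and their factorisation into linear factors.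

-- The value at (x, y) of the binary form with the given coefficients, where the
-- coefficient of the highest power of x comes first.
module _ (R : CommutativeRing c ℓ) (S : CommutativeRing c′ ℓ′)
         {f : CommutativeRing.Carrier R → CommutativeRing.Carrier S}
         (f-hom : IsRingHomomorphism (CommutativeRing.rawRing R) (CommutativeRing.rawRing S) f) where
  private module R = CommutativeRing R
  open CommutativeRing S
  open IsRingHomomorphism f-hom
  open SetoidReasoning setoid
  open SemiringExp semiring using (_^_)

  form : List R.Carrier → Carrier → Carrier → Carrier
  form []       x y = 0#
  form (k ∷ ks) x y = f k * x ^ length ks + y * form ks x y

  form-replicate : ∀ n ks x y → form (replicate n R.0# ++ ks) x y ≈ y ^ n * form ks x y
  form-replicate zero    ks x y = sym (*-identityˡ _)
  form-replicate (suc n) ks x y = begin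
    f R.0# * x ^ length (replicate n R.0# ++ ks) + y * form (replicate n R.0# ++ ks) x y
      ≈⟨ +-cong (trans (*-congʳ 0#-homo) (zeroˡ _)) (*-congˡ (form-replicate n ks x y)) ⟩
    0# + y * (y ^ n * form ks x y)    ≈⟨ +-identityˡ _ ⟩
    y * (y ^ n * form ks x y)         ≈⟨ *-assoc _ _ _ ⟨
    y ^ suc n * form ks x y           ∎

module _ (R : CommutativeRing c ℓ) where
  private module R = CommutativeRing R
  open R using (_≈_; _+_; _*_; _-_; 0#; 1#)

  formᴿ : List R.Carrier → R.Carrier → R.Carrier → R.Carrier
  formᴿ = form R R (isRingHomomorphism R.rawRing R.refl)

  -- Horner's scheme for the division by x - ry. The leading coefficient `k` is a separate argument
  -- because it accumulates the successive coefficients and ends as the remainder.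
  quotient : R.Carrier → R.Carrier → List R.Carrier → List R.Carrier
  quotient r k []        = []
  quotient r k (k′ ∷ ks) = k ∷ quotient r (k′ + r * k) ks

  remainder : R.Carrier → R.Carrier → List R.Carrier → R.Carrier
  remainder r k []        = k
  remainder r k (k′ ∷ ks) = remainder r (k′ + r * k) ks

  length-quotient : ∀ r k ks → length (quotient r k ks) ≡ length ks
  length-quotient r k []        = ≡.refl
  length-quotient r k (k′ ∷ ks) = ≡.cong suc (length-quotient r (k′ + r * k) ks)

  module _ (S : CommutativeRing c′ ℓ′) {f : R.Carrier → CommutativeRing.Carrier S}
           (f-hom : IsRingHomomorphism R.rawRing (CommutativeRing.rawRing S) f) where
    private module S = CommutativeRing S
    open IsRingHomomorphism f-hom
    open SetoidReasoning S.setoid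
    open SemiringExp S.semiring using (_^_)
    open ℤSolver S using (solve; _:=_; _:+_; _:*_; _:-_; :-_)

    division : ∀ r k ks x y → form R S f-hom (k ∷ ks) x y S.≈
      (x S.- f r S.* y) S.* form R S f-hom (quotient r k ks) x y S.+ f (remainder r k ks) S.* y ^ length ks
    division r k []        x y = begin
      f k S.* S.1# S.+ y S.* S.0#                      ≈⟨ S.+-comm _ _ ⟩
      y S.* S.0# S.+ f k S.* S.1#                      ≈⟨ S.+-congʳ (S.trans (S.zeroʳ _) (S.sym (S.zeroʳ _))) ⟩
      (x S.- f r S.* y) S.* S.0# S.+ f k S.* S.1#      ∎
    division r k (k′ ∷ ks) x y = begin
      f k S.* x ^ suc (length ks) S.+ y S.* (f k′ S.* x ^ length ks S.+ y S.* F)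
        ≈⟨ solve 7 (λ x y r k k′ p F →
             k :* (x :* p) :+ y :* (k′ :* p :+ y :* F)
             := (x :- r :* y) :* (k :* p) :+ y :* ((k′ :+ r :* k) :* p :+ y :* F))
             S.refl x y (f r) (f k) (f k′) (x ^ length ks) F ⟩
      (x S.- f r S.* y) S.* (f k S.* x ^ length ks) S.+ y S.* ((f k′ S.+ f r S.* f k) S.* x ^ length ks S.+ y S.* F)
        ≈⟨ S.+-congˡ (S.*-congˡ (S.+-congʳ (S.*-congʳ
             (S.trans (+-homo _ _) (S.+-congˡ (*-homo _ _)))))) ⟨
      (x S.- f r S.* y) S.* (f k S.* x ^ length ks) S.+ y S.* form R S f-hom (k″ ∷ ks) x y
        ≈⟨ S.+-cong (S.*-congˡ (S.*-congˡ (S.reflexive (≡.cong (x ^_) (≡.sym (length-quotient r k″ ks))))))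
                    (S.*-congˡ (division r k″ ks x y)) ⟩
      (x S.- f r S.* y) S.* (f k S.* x ^ length Q) S.+ y S.* ((x S.- f r S.* y) S.* G S.+ ρ S.* y ^ length ks)
        ≈⟨ solve 6 (λ x-ry kp y G ρ p →
             x-ry :* kp :+ y :* (x-ry :* G :+ ρ :* p) := x-ry :* (kp :+ y :* G) :+ ρ :* (y :* p))
             S.refl (x S.- f r S.* y) (f k S.* x ^ length Q) y G ρ (y ^ length ks) ⟩
      (x S.- f r S.* y) S.* (f k S.* x ^ length Q S.+ y S.* G) S.+ ρ S.* (y S.* y ^ length ks)
        ∎
      where
      k″ = k′ + r * k
      F  = form R S f-hom ks x y
      Q  = quotient r k″ ks
      G  = form R S f-hom Q x y
      ρ  = f (remainder r k″ ks)

  private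
    division-at-1 : ∀ r k ks r′ → formᴿ (k ∷ ks) r′ 1# ≈
      (r′ - r) * formᴿ (quotient r k ks) r′ 1# + remainder r k ks
    division-at-1 r k ks r′ = R.trans (division R (isRingHomomorphism R.rawRing R.refl) r k ks r′ 1#)
      (R.+-cong (R.*-congʳ (R.+-congˡ (R.-‿cong (R.*-identityʳ r))))
                (R.trans (R.*-congˡ (1^n≈1 R (length ks))) (R.*-identityʳ _)))

  remainder-root : ∀ r k ks → formᴿ (k ∷ ks) r 1# ≈ 0# → remainder r k ks ≈ 0#
  remainder-root r k ks root = begin
    ρ                    ≈⟨ R.+-identityˡ ρ ⟨
    0# + ρ               ≈⟨ R.+-congʳ (R.zeroˡ _) ⟨
    0# * G + ρ           ≈⟨ R.+-congʳ (R.*-congʳ (R.-‿inverseʳ r)) ⟨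
    (r - r) * G + ρ      ≈⟨ division-at-1 r k ks r ⟨
    formᴿ (k ∷ ks) r 1#  ≈⟨ root ⟩
    0#                   ∎
    where
    open SetoidReasoning R.setoid
    ρ = remainder r k ks
    G = formᴿ (quotient r k ks) r 1#

  -- The remainder vanishes, so r′ - r times the value of the quotient at r′ is zero. Cancelling r′
  -- - r uses its inverse.
  quotient-root : ∀ r k ks r′ → formᴿ (k ∷ ks) r 1# ≈ 0# → IsUnit R (r′ - r) →
                  formᴿ (k ∷ ks) r′ 1# ≈ 0# → formᴿ (quotient r k ks) r′ 1# ≈ 0#
  quotient-root r k ks r′ root unit root′ = isUnit-cancel R unit (begin
    (r′ - r) * G           ≈⟨ R.+-identityʳ _ ⟨
    (r′ - r) * G + 0#      ≈⟨ R.+-congˡ (remainder-root r k ks root) ⟨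
    (r′ - r) * G + ρ       ≈⟨ division-at-1 r k ks r′ ⟨
    formᴿ (k ∷ ks) r′ 1#   ≈⟨ root′ ⟩
    0#                     ∎)
    where
    open SetoidReasoning R.setoid
    ρ = remainder r k ks
    G = formᴿ (quotient r k ks) r′ 1#

  module _ (S : CommutativeRing c′ ℓ′) {f : R.Carrier → CommutativeRing.Carrier S}
           (f-hom : IsRingHomomorphism R.rawRing (CommutativeRing.rawRing S) f) where
    private module S = CommutativeRing S
    open IsRingHomomorphism f-hom
    open SetoidReasoning S.setoid

    -- Induction on the roots: the factor of the first root splits off, and the other roots remain
    -- roots of the quotient. The roots are compared in `R`, where their differences are units,
    -- while x and y may lie in a ring `S` with zero divisors.
    factorisation : ∀ rs k ks → length ks ≡ length rs →
      AllPairs (λ r r′ → IsUnit R (r′ - r)) rs →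
      All (λ r → formᴿ (k ∷ ks) r 1# ≈ 0#) rs → ∀ x y →
      form R S f-hom (k ∷ ks) x y S.≈ f k S.* foldr S._*_ S.1# (map (λ r → x S.- f r S.* y) rs)
    factorisation []       k []        _   _ _ x y =
      S.trans (S.+-congˡ (S.zeroʳ y)) (S.+-identityʳ _)
    factorisation (r ∷ rs) k (k′ ∷ ks) len (apart ∷ aparts) (root ∷ roots) x y = begin
      form R S f-hom (k ∷ k′ ∷ ks) x y
        ≈⟨ division S f-hom r k (k′ ∷ ks) x y ⟩
      L S.* form R S f-hom (k ∷ ks′) x y S.+ f (remainder r k (k′ ∷ ks)) S.* _
        ≈⟨ S.+-congˡ (S.trans (S.*-congʳ (S.trans (⟦⟧-cong (remainder-root r k (k′ ∷ ks) root)) 0#-homo)) (S.zeroˡ _)) ⟩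
      L S.* form R S f-hom (k ∷ ks′) x y S.+ S.0#
        ≈⟨ S.+-identityʳ _ ⟩
      L S.* form R S f-hom (k ∷ ks′) x y
        ≈⟨ S.*-congˡ (factorisation rs k ks′
             (≡.trans (length-quotient r (k′ + r * k) ks) (ℕ.suc-injective len)) aparts
             (All.zipWith (λ {r′} (unit , root′) → quotient-root r k (k′ ∷ ks) r′ root unit root′) (apart , roots))
             x y) ⟩
      L S.* (f k S.* Π)
        ≈⟨ solve 3 (λ L k p → L :* (k :* p) := k :* (L :* p)) S.refl L (f k) Π ⟩
      f k S.* (L S.* Π)
        ∎
      where
      open ℤSolver S using (solve; _:=_; _:*_)
      L   = x S.- f r S.* y
      ks′ = quotient r (k′ + r * k) ks
      Π   = foldr S._*_ S.1# (map (λ r → x S.- f r S.* y) rs)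

-- Fractions in lowest terms.

-- In lowest terms, k / n = index k n / order k n.
index order : ℕ → ℕ → ℕ
index k n = ℕ._∣_.quotient (gcd[m,n]∣m k n)
order k n = ℕ._∣_.quotient (gcd[m,n]∣n k n)

index*gcd : ∀ k n → index k n ℕ.* gcd k n ≡ k
index*gcd k n = ≡.sym (ℕ._∣_.equality (gcd[m,n]∣m k n))

order*gcd : ∀ k n → order k n ℕ.* gcd k n ≡ n
order*gcd k n = ≡.sym (ℕ._∣_.equality (gcd[m,n]∣n k n))

module _ (k n : ℕ) .{{n≢0 : NonZero n}} where
  private
    instance
      gcd≢0 : NonZero (gcd k n)
      gcd≢0 = ℕ.≢-nonZero (λ gcd≡0 → ℕ.≢-nonZero⁻¹ n (GCD.gcd[m,n]≡0⇒n≡0 k gcd≡0))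

  order-nonZero : NonZero (order k n)
  order-nonZero = ℕ.≢-nonZero (λ order≡0 → ℕ.≢-nonZero⁻¹ n
    (≡.trans (≡.sym (order*gcd k n)) (≡.cong (ℕ._* gcd k n) order≡0)))

  index-order-coprime : Coprime (index k n) (order k n)
  index-order-coprime = GCD≡1⇒coprime (GCD.GCD-* (≡.subst₂ (λ i o → GCD.GCD i o (1 ℕ.* gcd k n))
    (≡.sym (index*gcd k n)) (≡.sym (order*gcd k n))
    (≡.subst (GCD.GCD k n) (≡.sym (ℕ.*-identityˡ (gcd k n))) (GCD.gcd-GCD k n))))

  order≡⇒gcd≡ : ∀ {d g} → n ≡ d ℕ.* g → order k n ≡ d → gcd k n ≡ g
  order≡⇒gcd≡ {d} {g} n≡dg ≡.refl =
    ℕ.*-cancelˡ-≡ (gcd k n) g d {{order-nonZero}} (≡.trans (order*gcd k n) n≡dg)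

  -- If m = e · order, then order · gcd = n = mq gives gcd = eq, and the gcd divides k. Together
  -- with `∣⇒order-∣` this says that q ∤ k exactly when the order of k does not divide m.
  order-∣⇒∣ : ∀ {m q} .{{_ : NonZero m}} → n ≡ m ℕ.* q → order k n ℕ.∣ m → q ℕ.∣ k
  order-∣⇒∣ {m} {q} n≡mq (divides e m≡eo) = ℕ.∣-trans (divides e gcd≡eq) (gcd[m,n]∣m k n)
    where
    gcd≡eq : gcd k n ≡ e ℕ.* q
    gcd≡eq = ℕ.*-cancelˡ-≡ _ _ (order k n) {{order-nonZero}} (begin
      order k n ℕ.* gcd k n       ≡⟨ order*gcd k n ⟩
      n                           ≡⟨ n≡mq ⟩
      m ℕ.* q                     ≡⟨ ≡.cong (ℕ._* q) (≡.trans m≡eo (ℕ.*-comm e _)) ⟩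
      order k n ℕ.* e ℕ.* q       ≡⟨ ℕ.*-assoc (order k n) e q ⟩
      order k n ℕ.* (e ℕ.* q)     ∎)
      where open ≡.≡-Reasoning

  ∣⇒order-∣ : ∀ {m q} .{{_ : NonZero q}} → n ≡ m ℕ.* q → q ℕ.∣ k → order k n ℕ.∣ m
  ∣⇒order-∣ {m} {q} n≡mq q∣k with gcd-greatest q∣k (divides m n≡mq)
  ... | divides e gcd≡eq = divides e (ℕ.*-cancelʳ-≡ m (e ℕ.* order k n) q (begin
    m ℕ.* q                     ≡⟨ n≡mq ⟨
    n                           ≡⟨ order*gcd k n ⟨
    order k n ℕ.* gcd k n       ≡⟨ ≡.cong (order k n ℕ.*_) gcd≡eq ⟩
    order k n ℕ.* (e ℕ.* q)     ≡⟨ ℕ.*-assoc (order k n) e q ⟨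
    order k n ℕ.* e ℕ.* q       ≡⟨ ≡.cong (ℕ._* q) (ℕ.*-comm (order k n) e) ⟩
    e ℕ.* order k n ℕ.* q       ∎))
    where open ≡.≡-Reasoning

module _ (j d g : ℕ) .{{d≢0 : NonZero d}} .{{g≢0 : NonZero g}} where
  private
    instance
      dg≢0 : NonZero (d ℕ.* g)
      dg≢0 = ℕ.m*n≢0 d g

    gcd-* : gcd (j ℕ.* g) (d ℕ.* g) ≡ g ℕ.* gcd j d
    gcd-* = ≡.trans (≡.cong₂ gcd (ℕ.*-comm j g) (ℕ.*-comm d g)) (≡.sym (GCD.c*gcd[m,n]≡gcd[cm,cn] g j d))

  -- From gcd(jg, dg) = g · gcd(j, d). Among the multiples jg of g = n / d, those of order d are
  -- thus the ones with j prime to d, and these j index the linear factors of Φ_d.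
  order≡⇒coprime : order (j ℕ.* g) (d ℕ.* g) ≡ d → gcd j d ≡ 1
  order≡⇒coprime order≡d = ℕ.*-cancelˡ-≡ (gcd j d) 1 g
    (≡.trans (≡.sym gcd-*) (≡.trans (order≡⇒gcd≡ (j ℕ.* g) (d ℕ.* g) ≡.refl order≡d) (≡.sym (ℕ.*-identityʳ g))))

  private
    gcd≡g : gcd j d ≡ 1 → gcd (j ℕ.* g) (d ℕ.* g) ≡ g
    gcd≡g gcd≡1 = ≡.trans gcd-* (≡.trans (≡.cong (g ℕ.*_) gcd≡1) (ℕ.*-identityʳ g))

  coprime⇒order≡ : gcd j d ≡ 1 → order (j ℕ.* g) (d ℕ.* g) ≡ d
  coprime⇒order≡ gcd≡1 = ℕ.*-cancelʳ-≡ _ d g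
    (≡.trans (≡.cong (order (j ℕ.* g) (d ℕ.* g) ℕ.*_) (≡.sym (gcd≡g gcd≡1))) (order*gcd (j ℕ.* g) (d ℕ.* g)))

  coprime⇒index≡ : gcd j d ≡ 1 → index (j ℕ.* g) (d ℕ.* g) ≡ j
  coprime⇒index≡ gcd≡1 = ℕ.*-cancelʳ-≡ _ j g
    (≡.trans (≡.cong (index (j ℕ.* g) (d ℕ.* g) ℕ.*_) (≡.sym (gcd≡g gcd≡1))) (index*gcd (j ℕ.* g) (d ℕ.* g)))

-- The geometric sum of powers as a binary form.

module _ (R : CommutativeRing c ℓ) where
  open CommutativeRing R

  -- The form geometric (suc q) (x ^ suc m) (y ^ suc m), without its leading coefficient 1#.
  geometricTail : ℕ → ℕ → List Carrier
  geometricTail m zero    = []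
  geometricTail m (suc q) = replicate m 0# ++ 1# ∷ geometricTail m q

  length-geometricTail : ∀ m q → length (geometricTail m q) ≡ q ℕ.* suc m
  length-geometricTail m zero    = ≡.refl
  length-geometricTail m (suc q) = begin
    length (replicate m 0# ++ 1# ∷ geometricTail m q)        ≡⟨ List.length-++ (replicate m 0#) ⟩
    length (replicate m 0#) ℕ.+ suc (length (geometricTail m q))
      ≡⟨ ≡.cong₂ (λ a b → a ℕ.+ suc b) (List.length-replicate m) (length-geometricTail m q) ⟩
    m ℕ.+ suc (q ℕ.* suc m)                                   ≡⟨ ℕ.+-suc m _ ⟩
    suc (m ℕ.+ q ℕ.* suc m)                                   ∎
    where open ≡.≡-Reasoning

  module _ (S : CommutativeRing c′ ℓ′) {f : Carrier → CommutativeRing.Carrier S}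
           (f-hom : IsRingHomomorphism rawRing (CommutativeRing.rawRing S) f) where
    private module S = CommutativeRing S
    open SetoidReasoning S.setoid
    open SemiringExp S.semiring using (_^_; ^-assocʳ)

    form-geometric : ∀ m q x y → form R S f-hom (1# ∷ geometricTail m q) x y S.≈
                                 geometric S (suc q) (x ^ suc m) (y ^ suc m)
    form-geometric m zero x y =
      S.+-cong (S.trans (S.*-identityʳ _) (IsRingHomomorphism.1#-homo f-hom))
               (S.trans (S.zeroʳ _) (S.sym (S.zeroʳ _)))
    form-geometric m (suc q) x y = S.+-cong leading (begin
      y S.* form R S f-hom (replicate m 0# ++ 1# ∷ geometricTail m q) x y
        ≈⟨ S.*-congˡ (form-replicate R S f-hom m _ x y) ⟩
      y S.* (y ^ m S.* form R S f-hom (1# ∷ geometricTail m q) x y)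
        ≈⟨ S.*-assoc _ _ _ ⟨
      y ^ suc m S.* form R S f-hom (1# ∷ geometricTail m q) x y
        ≈⟨ S.*-congˡ (form-geometric m q x y) ⟩
      y ^ suc m S.* geometric S (suc q) (x ^ suc m) (y ^ suc m)
        ∎)
      where
      leading : f 1# S.* x ^ length (geometricTail m (suc q)) S.≈ (x ^ suc m) ^ suc q
      leading = begin
        f 1# S.* x ^ length (geometricTail m (suc q))
          ≈⟨ S.trans (S.*-congʳ (IsRingHomomorphism.1#-homo f-hom)) (S.*-identityˡ _) ⟩
        x ^ length (geometricTail m (suc q))
          ≡⟨ ≡.cong (x ^_) (≡.trans (length-geometricTail m (suc q)) (ℕ.*-comm (suc q) (suc m))) ⟩
        x ^ (suc m ℕ.* suc q)                          ≈⟨ ^-assocʳ x (suc m) (suc q) ⟨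
        (x ^ suc m) ^ suc q                            ∎

-- Counting the numbers that q does not divide.

length-filter-¬ : {A : Set a} {P : A → Set p} (P? : Decidable P) (xs : List A) →
  length (filter P? xs) ℕ.+ length (filter (¬? ∘ P?) xs) ≡ length xs
length-filter-¬ P? []       = ≡.refl
length-filter-¬ P? (x ∷ xs) with does (P? x)
... | true  = ≡.cong suc (length-filter-¬ P? xs)
... | false = ≡.trans (ℕ.+-suc _ _) (≡.cong suc (length-filter-¬ P? xs))

length-filter : {A : Set a} {P : A → Set p} (P? : Decidable P) (h : ℕ → A) → ∀ n →
  length (filter P? (applyUpTo h n)) ≡ ∏ ℕ.+-0-commutativeMonoid n (λ i → when ℕ.+-0-commutativeMonoid (P? (h i)) 1)
length-filter P? h n = ≡.trans (lemma (filter P? (applyUpTo h n)))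
                               (foldr-filter ℕ.+-0-commutativeMonoid P? (λ _ → 1) h n)
  where
  lemma : ∀ xs → length xs ≡ foldr ℕ._+_ 0 (map (λ _ → 1) xs)
  lemma []       = ≡.refl
  lemma (x ∷ xs) = ≡.cong suc (lemma xs)

length-multiples : ∀ m q .{{_ : NonZero q}} → length (filter (q ∣?_) (applyUpTo suc (m ℕ.* q))) ≡ m
length-multiples m q = begin
  length (filter (q ∣?_) (applyUpTo suc (m ℕ.* q)))   ≡⟨ length-filter (q ∣?_) suc (m ℕ.* q) ⟩
  ∑ (m ℕ.* q) (F ∘ suc)
    ≡⟨ ∏-multiples +-0 q m F (λ k q∤k → when-false +-0 (q ∣? k) q∤k) ⟩
  ∑ m (λ j → F (suc j ℕ.* q))
    ≡⟨ ∏-cong +-0 m (λ j _ → when-true +-0 (q ∣? (suc j ℕ.* q)) (ℕ.n∣m*n (suc j))) ⟩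
  ∑ m (λ _ → 1)                                       ≡⟨ ∑-1 m ⟩
  m                                                   ∎
  where
  open ≡.≡-Reasoning
  +-0 = ℕ.+-0-commutativeMonoid
  ∑ = ∏ +-0
  F : ℕ → ℕ
  F k = when +-0 (q ∣? k) 1
  ∑-1 : ∀ m → ∑ m (λ _ → 1) ≡ m
  ∑-1 zero    = ≡.refl
  ∑-1 (suc m) = ≡.cong suc (∑-1 m)

-- The count (q - 1)m is the degree of (xⁿ - yⁿ) / (xᵐ - yᵐ) for n = mq, so the roots with q ∤ k are
-- all of its roots. `factorisation` requires this equality.
length-nonMultiples : ∀ m q′ → let q = suc q′ in
  length (filter (¬? ∘ (q ∣?_)) (applyUpTo suc (m ℕ.* q))) ≡ q′ ℕ.* m
length-nonMultiples m q′ = ℕ.+-cancelˡ-≡ m _ _ (begin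
  m ℕ.+ length (filter (¬? ∘ (q ∣?_)) (applyUpTo suc (m ℕ.* q)))
    ≡⟨ ≡.cong (ℕ._+ length (filter (¬? ∘ (q ∣?_)) (applyUpTo suc (m ℕ.* q)))) (length-multiples m q) ⟨
  length (filter (q ∣?_) (applyUpTo suc (m ℕ.* q))) ℕ.+ length (filter (¬? ∘ (q ∣?_)) (applyUpTo suc (m ℕ.* q)))
    ≡⟨ length-filter-¬ (q ∣?_) (applyUpTo suc (m ℕ.* q)) ⟩
  length (applyUpTo suc (m ℕ.* q))
    ≡⟨ List.length-applyUpTo suc (m ℕ.* q) ⟩
  m ℕ.* q
    ≡⟨ ℕ.*-comm m q ⟩
  m ℕ.+ q′ ℕ.* m
    ∎)
  where
  open ≡.≡-Reasoning
  q = suc q′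

-- Apartness of roots of unity.

module _ (K : FieldWithRootsOfUnity c ℓ₁ ℓ₂) where
  open FieldWithRootsOfUnity K using (heytingCommutativeRing; _#_; ζ; ζ-primitive)
  open HeytingCommutativeRing heytingCommutativeRing using (#⇒invertible; commutativeRing)
  open CommutativeRing commutativeRing
  open SemiringExp semiring using (_^_; ^-congˡ; ^-homo-*; ^-assocʳ)
  open SetoidReasoning setoid

  private
    Unit : Carrier → Set _
    Unit = IsUnit commutativeRing

    #⇒unit : ∀ {x y} → x # y → Unit (x - y)
    #⇒unit x#y with #⇒invertible x#y
    ... | u , ux≈1 , _ = u , ux≈1

    unit-sym : ∀ {x y} → Unit (x - y) → Unit (y - x)
    unit-sym {x} {y} = isUnit-cong commutativeRing (solve 2 (λ x y → :- (x :- y) := y :- x) refl x y)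
                     ∘ isUnit-neg commutativeRing
      where open ℤSolver commutativeRing using (solve; _:=_; _:-_; :-_)

    -- By telescoping, x - y divides xⁿ - yⁿ, and a divisor of a unit is a unit.
    unit-^ : ∀ n {x y} → Unit (x ^ n - y ^ n) → Unit (x - y)
    unit-^ n {x} {y} = isUnit-*⁻ˡ commutativeRing ∘ isUnit-cong commutativeRing (sym (telescope commutativeRing n x y))

    -‿cong₂ : ∀ {x x′ y y′} → x ≈ x′ → y ≈ y′ → x - y ≈ x′ - y′
    -‿cong₂ x≈x′ y≈y′ = +-cong x≈x′ (-‿cong y≈y′)

  module _ (d : ℕ) .{{d≢0 : NonZero d}} where
    ζ^d≈1 : ζ d ^ d ≈ 1#
    ζ^d≈1 = proj₁ (ζ-primitive d)

    ζ^multiple≈1 : ∀ n → d ℕ.∣ n → ζ d ^ n ≈ 1#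
    ζ^multiple≈1 _ (divides e ≡.refl) = begin
      ζ d ^ (e ℕ.* d)   ≡⟨ ≡.cong (ζ d ^_) (ℕ.*-comm e d) ⟩
      ζ d ^ (d ℕ.* e)   ≈⟨ ^-assocʳ (ζ d) d e ⟨
      (ζ d ^ d) ^ e     ≈⟨ ^-congˡ e ζ^d≈1 ⟩
      1# ^ e            ≈⟨ 1^n≈1 commutativeRing e ⟩
      1#                ∎

    -- Primitivity speaks only of exponents strictly between 0 and d, so the exponent is first
    -- reduced modulo d.
    ζ^nonMultiple-unit : ∀ n → d ∤ n → Unit (ζ d ^ n - 1#)
    ζ^nonMultiple-unit n d∤n = isUnit-cong commutativeRing (+-congʳ ζ^%≈)
      (#⇒unit (proj₂ (ζ-primitive d) (n % d) (ℕ.n≢0⇒n>0 (d∤n ∘ ℕ.m%n≡0⇒n∣m n d)) (m%n<n n d)))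
      where
      ζ^%≈ : ζ d ^ (n % d) ≈ ζ d ^ n
      ζ^%≈ = begin
        ζ d ^ (n % d)                          ≈⟨ *-identityʳ _ ⟨
        ζ d ^ (n % d) * 1#                     ≈⟨ *-congˡ (ζ^multiple≈1 (n / d ℕ.* d) (ℕ.n∣m*n (n / d))) ⟨
        ζ d ^ (n % d) * ζ d ^ (n / d ℕ.* d)    ≈⟨ ^-homo-* (ζ d) (n % d) (n / d ℕ.* d) ⟨
        ζ d ^ (n % d ℕ.+ n / d ℕ.* d)          ≡⟨ ≡.cong (ζ d ^_) (m≡m%n+[m/n]*n n d) ⟨
        ζ d ^ n                                ∎

    ζ^-unit : ∀ i → Unit (ζ d ^ i)
    -- The exponents i(d - 1) and i add up to a multiple of d.
    ζ^-unit i = ζ d ^ (i ℕ.* ℕ.pred d) , (begin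
      ζ d ^ (i ℕ.* ℕ.pred d) * ζ d ^ i  ≈⟨ ^-homo-* (ζ d) (i ℕ.* ℕ.pred d) i ⟨
      ζ d ^ (i ℕ.* ℕ.pred d ℕ.+ i)      ≈⟨ ζ^multiple≈1 _ (divides i (≡.trans (ℕ.+-comm _ i)
                                            (≡.trans (≡.sym (ℕ.*-suc i (ℕ.pred d))) (≡.cong (i ℕ.*_) (ℕ.suc-pred d))))) ⟩
      1#                                ∎)

    -- The difference is ζⁱ (ζʲ⁻ⁱ - 1), where 0 < j - i < d.
    sameOrder-apart : ∀ i j → 0 ℕ.< i → i ℕ.< j → j ℕ.≤ d → Unit (ζ d ^ j - ζ d ^ i)
    sameOrder-apart i j 0<i i<j j≤d = isUnit-cong commutativeRing (begin
      ζ d ^ i * (ζ d ^ (j ℕ.∸ i) - 1#)        ≈⟨ trans (x[y-z]≈xy-xz _ _ _) (+-congˡ (-‿cong (*-identityʳ _))) ⟩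
      ζ d ^ i * ζ d ^ (j ℕ.∸ i) - ζ d ^ i     ≈⟨ +-congʳ (^-homo-* (ζ d) i (j ℕ.∸ i)) ⟨
      ζ d ^ (i ℕ.+ (j ℕ.∸ i)) - ζ d ^ i       ≡⟨ ≡.cong (λ k → ζ d ^ k - ζ d ^ i) (ℕ.m+[n∸m]≡n (ℕ.<⇒≤ i<j)) ⟩
      ζ d ^ j - ζ d ^ i                       ∎)
      (isUnit-* commutativeRing (ζ^-unit i) (ζ^nonMultiple-unit (j ℕ.∸ i)
        (ℕ.>⇒∤ {{ℕ.>-nonZero (ℕ.m<n⇒0<n∸m i<j)}} (ℕ.<-≤-trans (ℕ.∸-monoʳ-< 0<i (ℕ.<⇒≤ i<j)) j≤d))))
      where
      open RingProperties ring using (x[y-z]≈xy-xz)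

  -- Raising to the d-th power turns the second root into 1, but not the first: e is prime to j and
  -- does not divide d, so it does not divide jd. No relation between `ζ d` and `ζ e` enters.
  differentOrder-apart : ∀ d e .{{_ : NonZero d}} .{{_ : NonZero e}} i j → Coprime j e → e ∤ d →
                         Unit (ζ e ^ j - ζ d ^ i)
  differentOrder-apart d e i j j⊥e e∤d = unit-^ d (isUnit-cong commutativeRing
    (-‿cong₂ (sym (^-assocʳ (ζ e) j d))
             (trans (sym (ζ^multiple≈1 d (i ℕ.* d) (ℕ.n∣m*n i))) (sym (^-assocʳ (ζ d) i d))))
    (ζ^nonMultiple-unit e (j ℕ.* d) (e∤d ∘ coprime-divisor (Coprimality.sym j⊥e))))

  module _ (n : ℕ) .{{n≢0 : NonZero n}} where

    root : ℕ → Carrier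
    root k = ζ (order k n) ^ index k n

    -- If one order does not divide the other, a power separates the two roots. Otherwise the orders
    -- agree, hence so do the gcds with n, and k < l ≤ n becomes a strict inequality of the indices,
    -- bounded by the common order.
    root-apart : ∀ k l → 0 ℕ.< k → k ℕ.< l → l ℕ.≤ n → Unit (root l - root k)
    root-apart k l 0<k k<l l≤n with order l n ∣? order k n | order k n ∣? order l n
    ... | no l∤k  | _       = differentOrder-apart (order k n) (order l n) {{order-nonZero k n}} {{order-nonZero l n}}
                                (index k n) (index l n) (index-order-coprime l n) l∤k
    ... | yes _   | no k∤l  = unit-sym (differentOrder-apart (order l n) (order k n) {{order-nonZero l n}} {{order-nonZero k n}}
                                (index l n) (index k n) (index-order-coprime k n) k∤l)
    ... | yes l∣k | yes k∣l = ≡.subst (λ o → Unit (ζ o ^ index l n - root k)) order≡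
      (sameOrder-apart (order k n) {{order-nonZero k n}} (index k n) (index l n) 0<index index<index index≤order)
      where
      order≡ : order k n ≡ order l n
      order≡ = ℕ.∣-antisym k∣l l∣k
      g = gcd k n
      gcd≡ : gcd l n ≡ g
      gcd≡ = order≡⇒gcd≡ l n (≡.sym (order*gcd k n)) (≡.sym order≡)
      index*g : index l n ℕ.* g ≡ l
      index*g = ≡.trans (≡.cong (index l n ℕ.*_) (≡.sym gcd≡)) (index*gcd l n)
      0<index : 0 ℕ.< index k n
      0<index = ℕ.n≢0⇒n>0 (λ index≡0 → ℕ.>⇒≢ 0<k (≡.trans (≡.sym (index*gcd k n)) (≡.cong (ℕ._* g) index≡0)))
      index<index : index k n ℕ.< index l n
      index<index = ℕ.*-cancelʳ-< g _ _ (≡.subst₂ ℕ._<_ (≡.sym (index*gcd k n)) (≡.sym index*g) k<l)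
      index≤order : index l n ℕ.≤ order k n
      index≤order = ℕ.*-cancelʳ-≤ _ _ g {{ℕ.≢-nonZero λ g≡0 → ℕ.≢-nonZero⁻¹ n (GCD.gcd[m,n]≡0⇒n≡0 k g≡0)}}
        (≡.subst₂ ℕ._≤_ (≡.sym index*g) (≡.sym (order*gcd k n)) l≤n)

    root^n≈1 : ∀ k → root k ^ n ≈ 1#
    root^n≈1 k = trans (^-assocʳ _ (index k n) n)
      (ζ^multiple≈1 (order k n) {{order-nonZero k n}} _
        (ℕ.∣n⇒∣m*n (index k n) (divides (gcd k n) (≡.trans (≡.sym (order*gcd k n)) (ℕ.*-comm (order k n) _)))))

    root^m-unit : ∀ m k → order k n ∤ m → Unit (root k ^ m - 1#)
    root^m-unit m k order∤m = isUnit-cong commutativeRing (+-congʳ (sym (^-assocʳ _ (index k n) m)))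
      (ζ^nonMultiple-unit (order k n) {{order-nonZero k n}} (index k n ℕ.* m)
        (order∤m ∘ coprime-divisor (Coprimality.sym (index-order-coprime k n))))

-- Factorisation of the geometric sum into cyclotomic factors.

module _ (K : FieldWithRootsOfUnity c ℓ₁ ℓ₂) (S : CommutativeRing c′ ℓ′)
         {f : FieldWithRootsOfUnity.Carrier K → CommutativeRing.Carrier S}
         (f-hom : IsRingHomomorphism (FieldWithRootsOfUnity.rawRing K) (CommutativeRing.rawRing S) f) where
  open HeytingCommutativeRing (FieldWithRootsOfUnity.heytingCommutativeRing K) using (commutativeRing)
  open CommutativeRing commutativeRing
  open SemiringExp semiring using (_^_; ^-assocʳ)
  private
    module S = CommutativeRing S
    module S^ = SemiringExp S.semiring
    *-S = S.*-commutativeMonoid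

  geometric-roots : ∀ m q .{{_ : NonZero m}} .{{_ : NonZero q}} x y →
    let instance _ = ℕ.m*n≢0 m q in
    geometric S q (x S^.^ m) (y S^.^ m) S.≈
    ∏ *-S (m ℕ.* q) (λ i → when *-S (¬? (q ∣? suc i)) (x S.- f (root K (m ℕ.* q) (suc i)) S.* y))
  geometric-roots m@(suc m′) q@(suc q′) x y = begin
    geometric S q (x S^.^ m) (y S^.^ m)
      ≈⟨ form-geometric commutativeRing S f-hom m′ q′ x y ⟨
    form commutativeRing S f-hom (1# ∷ geometricTail commutativeRing m′ q′) x y
      ≈⟨ factorisation commutativeRing S f-hom (map (root K n) ks) 1# (geometricTail commutativeRing m′ q′)
           (≡.trans (length-geometricTail commutativeRing m′ q′)
             (≡.sym (≡.trans (List.length-map (root K n) ks) (length-nonMultiples m q′))))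
           (AllPairs.map⁺ (AllPairs.filter⁺ (¬? ∘ (q ∣?_)) (AllPairs.applyUpTo⁺₁ suc n
             (λ {i} {j} i<j j<n → root-apart K n (suc i) (suc j) z<s (s<s i<j) j<n))))
           (All.map⁺ (All.map (λ {k} → isRoot k) (All.all-filter (¬? ∘ (q ∣?_)) (applyUpTo suc n))))
           x y ⟩
    f 1# S.* foldr S._*_ S.1# (map (λ r → x S.- f r S.* y) (map (root K n) ks))
      ≈⟨ S.trans (S.*-congʳ (IsRingHomomorphism.1#-homo f-hom)) (S.*-identityˡ _) ⟩
    foldr S._*_ S.1# (map (λ r → x S.- f r S.* y) (map (root K n) ks))
      ≡⟨ ≡.cong (foldr S._*_ S.1#) (List.map-∘ ks) ⟨
    foldr S._*_ S.1# (map (λ k → x S.- f (root K n k) S.* y) ks)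
      ≈⟨ foldr-filter *-S (¬? ∘ (q ∣?_)) (λ k → x S.- f (root K n k) S.* y) suc n ⟩
    ∏ *-S n (λ i → when *-S (¬? (q ∣? suc i)) (x S.- f (root K n (suc i)) S.* y))
      ∎
    where
    open SetoidReasoning S.setoid
    n  = m ℕ.* q
    ks = filter (¬? ∘ (q ∣?_)) (applyUpTo suc n)
    -- For r = `root K n k` the geometric sum times rᵐ - 1 is rⁿ - 1 = 0, and rᵐ - 1 is a unit
    -- because q ∤ k.
    isRoot : ∀ k → q ∤ k → formᴿ commutativeRing (1# ∷ geometricTail commutativeRing m′ q′) (root K n k) 1# ≈ 0#
    isRoot k q∤k = trans
      (form-geometric commutativeRing commutativeRing (isRingHomomorphism rawRing refl) m′ q′ (root K n k) 1#)
      (isUnit-cancel commutativeRing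
        (isUnit-cong commutativeRing (+-congˡ (-‿cong (sym (1^n≈1 commutativeRing m))))
          (root^m-unit K n m k (q∤k ∘ order-∣⇒∣ k n ≡.refl)))
        (trans (telescope commutativeRing q _ _)
          (trans (+-cong (trans (^-assocʳ _ m q) (root^n≈1 K n k))
                        (-‿cong (trans (^-assocʳ 1# m q) (1^n≈1 commutativeRing n))))
                 (-‿inverseʳ 1#))))

module _ (K : FieldWithRootsOfUnity c ℓ₁ ℓ₂) (S : CommutativeRing c′ ℓ′)
         {f : FieldWithRootsOfUnity.Carrier K → CommutativeRing.Carrier S}
         (f-hom : IsRingHomomorphism (FieldWithRootsOfUnity.rawRing K) (CommutativeRing.rawRing S) f)
         (x y : CommutativeRing.Carrier S) where
  open FieldWithRootsOfUnity K using (ζ; _^_)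
  private
    module S = CommutativeRing S
    module S^ = SemiringExp S.semiring
    *-S = S.*-commutativeMonoid

  cyclotomic : ℕ → S.Carrier
  cyclotomic d = ∏ *-S d (λ j → when *-S (gcd (suc j) d ℕ.≟ 1) (x S.- f (ζ d ^ suc j) S.* y))

  -- Each factor x - (root k) y is assigned to the order of its root.
  geometric-cyclotomic : ∀ m q .{{_ : NonZero m}} .{{_ : NonZero q}} →
    geometric S q (x S^.^ m) (y S^.^ m) S.≈
    ∏ *-S (m ℕ.* q) (λ i → when *-S ((suc i ∣? (m ℕ.* q)) ×-dec ¬? (suc i ∣? m)) (cyclotomic (suc i)))
  geometric-cyclotomic m q = begin
    geometric S q (x S^.^ m) (y S^.^ m)
      ≈⟨ geometric-roots K S f-hom m q x y ⟩
    ∏ *-S n (λ k → H (suc k))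
      ≈⟨ ∏-cong *-S n (λ k _ → single k) ⟨
    ∏ *-S n (λ k → ∏ *-S n (λ i → when *-S (order (suc k) n ℕ.≟ suc i) (H (suc k))))
      ≈⟨ ∏-comm *-S n n (λ k i → when *-S (order (suc k) n ℕ.≟ suc i) (H (suc k))) ⟩
    ∏ *-S n (λ i → ∏ *-S n (λ k → when *-S (order (suc k) n ℕ.≟ suc i) (H (suc k))))
      ≈⟨ ∏-cong *-S n (λ i _ → regroup (suc i)) ⟨
    ∏ *-S n (λ i → when *-S ((suc i ∣? n) ×-dec ¬? (suc i ∣? m)) (cyclotomic (suc i)))
      ∎
    where
    open SetoidReasoning S.setoid
    n = m ℕ.* q
    instance
      n≢0 : NonZero n
      n≢0 = ℕ.m*n≢0 m q

    F H : ℕ → S.Carrier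
    F k = x S.- f (root K n k) S.* y
    H k = when *-S (¬? (q ∣? k)) (F k)

    single : ∀ k → ∏ *-S n (λ i → when *-S (order (suc k) n ℕ.≟ suc i) (H (suc k))) S.≈ H (suc k)
    single k = S.trans
      (∏-single *-S {i = ℕ.pred d} pred<n
        (λ i i≢ → when-false *-S (d ℕ.≟ suc i) (λ d≡ → i≢ (≡.sym (≡.cong ℕ.pred d≡)))))
      (when-true *-S (d ℕ.≟ suc (ℕ.pred d)) (≡.sym suc-pred))
      where
      d = order (suc k) n
      suc-pred : suc (ℕ.pred d) ≡ d
      suc-pred = ℕ.suc-pred d {{order-nonZero (suc k) n}}
      pred<n : ℕ.pred d ℕ.< n
      pred<n = ≡.subst (ℕ._≤ n) (≡.sym suc-pred)
        (ℕ.∣⇒≤ (divides (gcd (suc k) n) (≡.trans (≡.sym (order*gcd (suc k) n)) (ℕ.*-comm d _))))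

    order∣n : ∀ k → order k n ℕ.∣ n
    order∣n k = divides (gcd k n) (≡.trans (≡.sym (order*gcd k n)) (ℕ.*-comm (order k n) _))

    none : ∀ d → ¬ (d ℕ.∣ n × d ∤ m) → ∀ k → when *-S (order k n ℕ.≟ d) (H k) S.≈ S.1#
    none d ¬d k = when-ε *-S (order k n ℕ.≟ d) λ { ≡.refl → when-false *-S (¬? (q ∣? k))
      (λ q∤k → ¬d (order∣n k , λ d∣m → q∤k (order-∣⇒∣ k n ≡.refl d∣m))) }

    -- For d dividing n but not m, put g = n / d. The k of order d are the multiples jg with j prime
    -- to d, and `root K n (jg)` is ζ(d)ʲ. For any other d, no k with q ∤ k has order d, so both
    -- sides are 1.
    regroup : ∀ d .{{_ : NonZero d}} →
      when *-S ((d ∣? n) ×-dec ¬? (d ∣? m)) (cyclotomic d) S.≈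
      ∏ *-S n (λ k → when *-S (order (suc k) n ℕ.≟ d) (H (suc k)))
    regroup d with d ∣? n | d ∣? m
    ... | no d∤n | _       = S.sym (∏-ε *-S n (λ k _ → none d (d∤n ∘ proj₁) (suc k)))
    ... | yes _  | yes d∣m = S.sym (∏-ε *-S n (λ k _ → none d (λ (_ , d∤m) → d∤m d∣m) (suc k)))
    ... | yes (divides g n≡gd) | no d∤m = S.sym (begin
      ∏ *-S n (λ k → f′ (suc k))            ≡⟨ ≡.cong (λ N → ∏ *-S N (f′ ∘ suc)) n≡dg ⟩
      ∏ *-S (d ℕ.* g) (f′ ∘ suc)            ≈⟨ ∏-multiples *-S g d f′ nonMultiple ⟩
      ∏ *-S d (λ j → f′ (suc j ℕ.* g))      ≈⟨ ∏-cong *-S d (λ j _ → multiple (suc j)) ⟩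
      cyclotomic d                          ∎)
      where
      n≡dg : n ≡ d ℕ.* g
      n≡dg = ≡.trans n≡gd (ℕ.*-comm g d)
      instance
        g≢0 : NonZero g
        g≢0 = ℕ.≢-nonZero (λ g≡0 → ℕ.≢-nonZero⁻¹ n (≡.trans n≡gd (≡.cong (ℕ._* d) g≡0)))
      f′ : ℕ → S.Carrier
      f′ k = when *-S (order k n ℕ.≟ d) (H k)
      nonMultiple : ∀ k → g ∤ k → f′ k S.≈ S.1#
      nonMultiple k g∤k = when-false *-S (order k n ℕ.≟ d)
        (λ order≡d → g∤k (≡.subst (ℕ._∣ k) (order≡⇒gcd≡ k n n≡dg order≡d) (gcd[m,n]∣m k n)))
      multiple : ∀ j → f′ (j ℕ.* g) S.≈ when *-S (gcd j d ℕ.≟ 1) (x S.- f (ζ d ^ j) S.* y)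
      multiple j = when-⇔ *-S (order k n ℕ.≟ d) (gcd j d ℕ.≟ 1)
        (λ order≡d → order≡⇒coprime j d g (≡.subst (λ N → order k N ≡ d) n≡dg order≡d))
        (λ gcd≡1 → ≡.subst (λ N → order k N ≡ d) (≡.sym n≡dg) (coprime⇒order≡ j d g gcd≡1))
        (λ order≡d → S.trans
          (when-true *-S (¬? (q ∣? k))
            (λ q∣k → d∤m (≡.subst (ℕ._∣ m) order≡d (∣⇒order-∣ k n ≡.refl q∣k))))
          (S.reflexive (≡.cong₂ (λ o i → x S.- f (ζ o ^ i) S.* y) order≡d (index≡j order≡d))))
        where
        k = j ℕ.* g
        index≡j : order k n ≡ d → index k n ≡ j
        index≡j order≡d = ≡.subst (λ N → index k N ≡ j) (≡.sym n≡dg)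
          (coprime⇒index≡ j d g (order≡⇒coprime j d g (≡.subst (λ N → order k N ≡ d) n≡dg order≡d)))

-- The ring generated by a root of the characteristic polynomial.

-- R[X]/(X² - sX - t), where (a , b) stands for a + bX.
module QuadraticExtension (R : CommutativeRing c ℓ) (s t : CommutativeRing.Carrier R) where
  open CommutativeRing R
  open ℤSolver R using (solve; _:=_; _:+_; _:*_; _:-_; :-_)
  open RingProperties ring using (-0#≈0#)

  extension : CommutativeRing c ℓ
  extension = record
    { Carrier = Carrier × Carrier
    ; _≈_ = λ (a , b) (a′ , b′) → a ≈ a′ × b ≈ b′
    ; _+_ = λ (a , b) (a′ , b′) → a + a′ , b + b′
    ; _*_ = λ (a , b) (a′ , b′) → a * a′ + t * (b * b′) , a * b′ + b * a′ + s * (b * b′)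
    ; -_ = λ (a , b) → - a , - b
    ; 0# = 0# , 0#
    ; 1# = 1# , 0#
    ; isCommutativeRing = record
      { isRing = record
        { +-isAbelianGroup = record
          { isGroup = record
            { isMonoid = record
              { isSemigroup = record
                { isMagma = record
                  { isEquivalence = record
                    { refl = refl , refl
                    ; sym = λ (p , q) → sym p , sym q
                    ; trans = λ (p , q) (p′ , q′) → trans p p′ , trans q q′ }
                  ; ∙-cong = λ (p , q) (p′ , q′) → +-cong p p′ , +-cong q q′ }
                ; assoc = λ _ _ _ → +-assoc _ _ _ , +-assoc _ _ _ }
              ; identity = (λ _ → +-identityˡ _ , +-identityˡ _) , (λ _ → +-identityʳ _ , +-identityʳ _) }
            ; inverse = (λ _ → -‿inverseˡ _ , -‿inverseˡ _) , (λ _ → -‿inverseʳ _ , -‿inverseʳ _)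
            ; ⁻¹-cong = λ (p , q) → -‿cong p , -‿cong q }
          ; comm = λ _ _ → +-comm _ _ , +-comm _ _ }
        ; *-cong = λ (p , q) (p′ , q′) →
            +-cong (*-cong p p′) (*-congˡ (*-cong q q′)) ,
            +-cong (+-cong (*-cong p q′) (*-cong q p′)) (*-congˡ (*-cong q q′))
        ; *-assoc = λ (a , b) (a′ , b′) (a″ , b″) →
            solve 8 (λ s t a b c d e f →
              (a :* c :+ t :* (b :* d)) :* e :+ t :* ((a :* d :+ b :* c :+ s :* (b :* d)) :* f) :=
              a :* (c :* e :+ t :* (d :* f)) :+ t :* (b :* (c :* f :+ d :* e :+ s :* (d :* f))))
              refl s t a b a′ b′ a″ b″ ,
            solve 8 (λ s t a b c d e f →
              (a :* c :+ t :* (b :* d)) :* f :+ (a :* d :+ b :* c :+ s :* (b :* d)) :* e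
                :+ s :* ((a :* d :+ b :* c :+ s :* (b :* d)) :* f) :=
              a :* (c :* f :+ d :* e :+ s :* (d :* f)) :+ b :* (c :* e :+ t :* (d :* f))
                :+ s :* (b :* (c :* f :+ d :* e :+ s :* (d :* f))))
              refl s t a b a′ b′ a″ b″
        ; *-identity = (λ x → *-idˡ x) , (λ x → trans₂ (*-comm₂ x (1# , 0#)) (*-idˡ x))
        ; distrib = distribˡ₂ , (λ x y z → trans₂ (*-comm₂ (y +₂ z) x)
            (trans₂ (distribˡ₂ x y z) (+-cong (proj₁ (*-comm₂ x y)) (proj₁ (*-comm₂ x z)) ,
                                       +-cong (proj₂ (*-comm₂ x y)) (proj₂ (*-comm₂ x z)))))
        }
      ; *-comm = *-comm₂
      }
    }
    where
    infix 4 _≈₂_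
    _≈₂_ : Carrier × Carrier → Carrier × Carrier → Set ℓ
    (a , b) ≈₂ (a′ , b′) = a ≈ a′ × b ≈ b′
    trans₂ : ∀ {x y z} → x ≈₂ y → y ≈₂ z → x ≈₂ z
    trans₂ (p , q) (p′ , q′) = trans p p′ , trans q q′
    _+₂_ _*₂_ : Carrier × Carrier → Carrier × Carrier → Carrier × Carrier
    (a , b) +₂ (a′ , b′) = a + a′ , b + b′
    (a , b) *₂ (a′ , b′) = a * a′ + t * (b * b′) , a * b′ + b * a′ + s * (b * b′)
    *-comm₂ : ∀ x y → x *₂ y ≈₂ y *₂ x
    *-comm₂ (a , b) (a′ , b′) =
      solve 5 (λ t a b c d → a :* c :+ t :* (b :* d) := c :* a :+ t :* (d :* b)) refl t a b a′ b′ ,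
      solve 5 (λ s a b c d → a :* d :+ b :* c :+ s :* (b :* d) := c :* b :+ d :* a :+ s :* (d :* b)) refl s a b a′ b′
    *-idˡ : ∀ x → (1# , 0#) *₂ x ≈₂ x
    *-idˡ (a , b) =
      trans (+-cong (*-identityˡ a) (trans (*-congˡ (zeroˡ b)) (zeroʳ t))) (+-identityʳ a) ,
      trans (+-cong (trans (+-cong (*-identityˡ b) (zeroˡ a)) (+-identityʳ b)) (trans (*-congˡ (zeroˡ b)) (zeroʳ s)))
            (+-identityʳ b)
    distribˡ₂ : ∀ x y z → x *₂ (y +₂ z) ≈₂ (x *₂ y) +₂ (x *₂ z)
    distribˡ₂ (a , b) (a′ , b′) (a″ , b″) =
      solve 7 (λ t a b c d e f → a :* (c :+ e) :+ t :* (b :* (d :+ f))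
                 := a :* c :+ t :* (b :* d) :+ (a :* e :+ t :* (b :* f))) refl t a b a′ b′ a″ b″ ,
      solve 7 (λ s a b c d e f → a :* (d :+ f) :+ b :* (c :+ e) :+ s :* (b :* (d :+ f))
                 := a :* d :+ b :* c :+ s :* (b :* d) :+ (a :* f :+ b :* e :+ s :* (b :* f)))
               refl s a b a′ b′ a″ b″

  embed : Carrier → CommutativeRing.Carrier extension
  embed a = a , 0#

  embed-isRingHomomorphism : IsRingHomomorphism rawRing (CommutativeRing.rawRing extension) embed
  embed-isRingHomomorphism = mkIsRingHomomorphism
    (λ a≈b → a≈b , refl)
    (λ _ _ → refl , sym (+-identityˡ 0#))
    (λ a b → sym (trans (+-congˡ (trans (*-congˡ (zeroˡ 0#)) (zeroʳ t))) (+-identityʳ _)) ,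
             sym (trans (+-cong (trans (+-cong (zeroʳ a) (zeroˡ b)) (+-identityˡ 0#))
                                (trans (*-congˡ (zeroˡ 0#)) (zeroʳ s))) (+-identityˡ 0#)))
    (λ _ → refl , sym -0#≈0#)
    (refl , refl) (refl , refl)

  private module E = CommutativeRing extension

  -- The root X and its conjugate s - X. The second root lies in the extension as soon as the first
  -- does.
  X X̄ : E.Carrier
  X = 0# , 1#
  X̄ = s , - 1#

  X+X̄≈s : X E.+ X̄ E.≈ embed s
  X+X̄≈s = +-identityˡ s , -‿inverseʳ 1#

  -XX̄≈t : E.- (X E.* X̄) E.≈ embed t
  -XX̄≈t = (begin
      - (0# * s + t * (1# * - 1#))
        -- `0#` and `1#` enter as the variables z and o. The solver proves what holds for arbitrary
        -- values, and the next steps apply the laws of zero and one.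
        ≈⟨ solve 4 (λ z o s t → :- (z :* s :+ t :* (o :* :- o)) := t :* (o :* o) :- z :* s) refl 0# 1# s t ⟩
      t * (1# * 1#) - 0# * s                   ≈⟨ +-cong (*-congˡ (*-identityˡ 1#)) (-‿cong (zeroˡ s)) ⟩
      t * 1# - 0#                              ≈⟨ +-cong (*-identityʳ t) -0#≈0# ⟩
      t + 0#                                   ≈⟨ +-identityʳ t ⟩
      t                                        ∎) , (begin
      - (0# * - 1# + 1# * s + s * (1# * - 1#))
        ≈⟨ solve 3 (λ z o s → :- (z :* :- o :+ o :* s :+ s :* (o :* :- o)) := z :* o :+ (s :* (o :* o) :- o :* s)) refl 0# 1# s ⟩
      0# * 1# + (s * (1# * 1#) - 1# * s)
        ≈⟨ +-cong (zeroˡ 1#) (+-cong (trans (*-congˡ (*-identityˡ 1#)) (*-identityʳ s)) (-‿cong (*-identityˡ s))) ⟩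
      0# + (s - s)                             ≈⟨ trans (+-identityˡ _) (-‿inverseʳ s) ⟩
      0#                                       ∎)
    where open SetoidReasoning setoid

-- Lucas sequences and powers of the roots.

-- The companion Lucas sequence, xⁿ + yⁿ in terms of the roots x and y. It serves as the first
-- parameter of the sequence with roots xᵐ and yᵐ.
V : ℤ → ℤ → ℕ → ℤ
V s t 0             = + 2
V s t 1             = s
V s t (suc (suc n)) = s ℤ.* V s t (suc n) ℤ.+ t ℤ.* V s t n

module _ (A : CommutativeRing c ℓ) where
  open CommutativeRing A
  open SemiringExp semiring using (_^_; ^-homo-*)
  open CommutativeSemiringExp commutativeSemiring using (^-distrib-*)
  open SetoidReasoning setoid
  open ℤSolver A using (solve; _:=_; _:+_; _:*_; _:-_; :-_)
  open IsRingHomomorphism (fromℤ-isRingHomomorphism A)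
  open RingProperties ring using (-‿involutive)

  private
    ι : ℤ → Carrier
    ι = fromℤ rawRing

    ι-*+* : ∀ i j k l → ι (i ℤ.* j ℤ.+ k ℤ.* l) ≈ ι i * ι j + ι k * ι l
    ι-*+* i j k l = trans (+-homo (i ℤ.* j) (k ℤ.* l)) (+-cong (*-homo i j) (*-homo k l))

  module _ {s t : ℤ} {x y : Carrier} (x+y≈s : x + y ≈ ι s) (-xy≈t : - (x * y) ≈ ι t) where

    U-geometric : ∀ n → ι (U s t n) ≈ geometric A n x y
    U-geometric 0             = refl
    U-geometric 1             = begin
      1# + 0#          ≈⟨ +-congˡ (zeroʳ y) ⟨
      1# + y * 0#      ∎
    U-geometric (suc (suc n)) = begin
      ι (s ℤ.* U s t (suc n) ℤ.+ t ℤ.* U s t n)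
        ≈⟨ ι-*+* s (U s t (suc n)) t (U s t n) ⟩
      ι s * ι (U s t (suc n)) + ι t * ι (U s t n)
        ≈⟨ +-cong (*-cong (sym x+y≈s) (U-geometric (suc n))) (*-cong (sym -xy≈t) (U-geometric n)) ⟩
      (x + y) * geometric A (suc n) x y + - (x * y) * geometric A n x y
        ≈⟨ +-congˡ (RingProperties.-‿distribˡ-* ring _ _) ⟨
      (x + y) * geometric A (suc n) x y - x * y * geometric A n x y
        ≈⟨ geometric-recurrence A n x y ⟨
      geometric A (suc (suc n)) x y
        ∎

    V-powers : ∀ n → ι (V s t n) ≈ x ^ n + y ^ n
    V-powers 0             = +-congˡ (+-identityʳ 1#)
    V-powers 1             = trans (sym x+y≈s) (sym (+-cong (*-identityʳ x) (*-identityʳ y)))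
    V-powers (suc (suc n)) = begin
      ι (s ℤ.* V s t (suc n) ℤ.+ t ℤ.* V s t n)
        ≈⟨ ι-*+* s (V s t (suc n)) t (V s t n) ⟩
      ι s * ι (V s t (suc n)) + ι t * ι (V s t n)
        ≈⟨ +-cong (*-cong (sym x+y≈s) (V-powers (suc n))) (*-cong (sym -xy≈t) (V-powers n)) ⟩
      (x + y) * (x * x ^ n + y * y ^ n) + - (x * y) * (x ^ n + y ^ n)
        ≈⟨ solve 4 (λ x y p q → (x :+ y) :* (x :* p :+ y :* q) :+ :- (x :* y) :* (p :+ q)
                      := x :* (x :* p) :+ y :* (y :* q)) refl x y (x ^ n) (y ^ n) ⟩
      x ^ suc (suc n) + y ^ suc (suc n)
        ∎

    -- As xy = -t, the second parameter of the sequence with roots xᵐ and yᵐ is -(-t)ᵐ.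
    norm-powers : ∀ n → ι ((ℤ.- t) ℤ.^ n) ≈ x ^ n * y ^ n
    norm-powers n = begin
      ι ((ℤ.- t) ℤ.^ n)     ≈⟨ ^-homo n ⟩
      (x * y) ^ n           ≈⟨ ^-distrib-* x y n ⟩
      x ^ n * y ^ n         ∎
      where
      ^-homo : ∀ n → ι ((ℤ.- t) ℤ.^ n) ≈ (x * y) ^ n
      ^-homo zero    = 1#-homo
      ^-homo (suc n) = trans (*-homo (ℤ.- t) ((ℤ.- t) ℤ.^ n))
        (*-cong (trans (-‿homo t) (trans (-‿cong (sym -xy≈t)) (-‿involutive (x * y)))) (^-homo n))

    module _ (ι-injective : ∀ {i j} → ι i ≈ ι j → i ≡ j) where

      -- The identity x²ⁿ + y²ⁿ = (xⁿ + yⁿ)² - 2(xy)ⁿ in `A`, pulled back along the injective map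
      -- from the integers.
      V-double : ∀ n → V s t (n ℕ.+ n) ≡ V s t n ℤ.* V s t n ℤ.- + 2 ℤ.* (ℤ.- t) ℤ.^ n
      V-double n = ι-injective (begin
        ι (V s t (n ℕ.+ n))
          ≈⟨ V-powers (n ℕ.+ n) ⟩
        x ^ (n ℕ.+ n) + y ^ (n ℕ.+ n)
          ≈⟨ +-cong (^-homo-* x n n) (^-homo-* y n n) ⟩
        x ^ n * x ^ n + y ^ n * y ^ n
          ≈⟨ solve 2 (λ p q → p :* p :+ q :* q := (p :+ q) :* (p :+ q) :- (p :* q :+ p :* q)) refl (x ^ n) (y ^ n) ⟩
        (x ^ n + y ^ n) * (x ^ n + y ^ n) - (x ^ n * y ^ n + x ^ n * y ^ n)
          ≈⟨ +-cong (*-cong (V-powers n) (V-powers n)) (-‿cong (+-cong (norm-powers n) (norm-powers n))) ⟨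
        ι Vₙ * ι Vₙ - (ι Nₙ + ι Nₙ)
          ≈⟨ +-cong (*-homo Vₙ Vₙ) (-‿cong (+-homo Nₙ Nₙ)) ⟨
        ι (Vₙ ℤ.* Vₙ) - ι (Nₙ ℤ.+ Nₙ)
          ≈⟨ +-congˡ (-‿homo (Nₙ ℤ.+ Nₙ)) ⟨
        ι (Vₙ ℤ.* Vₙ) + ι (ℤ.- (Nₙ ℤ.+ Nₙ))
          ≈⟨ +-homo (Vₙ ℤ.* Vₙ) (ℤ.- (Nₙ ℤ.+ Nₙ)) ⟨
        ι (Vₙ ℤ.* Vₙ ℤ.- (Nₙ ℤ.+ Nₙ))
          ≡⟨ ≡.cong (λ k → ι (Vₙ ℤ.* Vₙ ℤ.- k)) (≡.sym (2*i≡i+i Nₙ)) ⟩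
        ι (Vₙ ℤ.* Vₙ ℤ.- + 2 ℤ.* Nₙ)
          ∎)
        where
        Vₙ Nₙ : ℤ
        Vₙ = V s t n
        Nₙ = (ℤ.- t) ℤ.^ n
        2*i≡i+i : ∀ i → + 2 ℤ.* i ≡ i ℤ.+ i
        2*i≡i+i i = ≡.trans (ℤ.*-distribʳ-+ i (+ 1) (+ 1)) (≡.cong₂ ℤ._+_ (ℤ.*-identityˡ i) (ℤ.*-identityˡ i))

-- From identities over K to identities between integers.

module _ (M : CommutativeMonoid c ℓ) (N : CommutativeMonoid c′ ℓ′)
         (f : CommutativeMonoid.Carrier M → CommutativeMonoid.Carrier N) where
  private
    module M = CommutativeMonoid M
    module N = CommutativeMonoid N

  ∏-homo : f M.ε N.≈ N.ε → (∀ x y → f (x M.∙ y) N.≈ f x N.∙ f y) →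
           ∀ n g → f (∏ M n g) N.≈ ∏ N n (f ∘ g)
  ∏-homo ε-homo ∙-homo zero    g = ε-homo
  ∏-homo ε-homo ∙-homo (suc n) g =
    N.trans (∙-homo _ _) (N.∙-congˡ (∏-homo ε-homo ∙-homo n (g ∘ suc)))

  when-homo : f M.ε N.≈ N.ε → {P : Set p} (P? : Dec P) (x : M.Carrier) →
              f (when M P? x) N.≈ when N P? (f x)
  when-homo ε-homo (yes _) x = N.refl
  when-homo ε-homo (no _)  x = ε-homo

module _ (K : FieldWithRootsOfUnity c ℓ₁ ℓ₂) where
  open FieldWithRootsOfUnity K using (heytingField; characteristicZero; ζ; _^_) renaming (rawRing to R)
  open HeytingField heytingField using (heytingCommutativeRing; #-irrefl)
  open HeytingCommutativeRing heytingCommutativeRing using (commutativeRing)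
  private module F = CommutativeRing commutativeRing

  fromℤ-kernel : ∀ i → fromℤ R i F.≈ F.0# → i ≡ + 0
  fromℤ-kernel (+ zero)    _    = ≡.refl
  fromℤ-kernel (+ suc n)   ιi≈0 = contradiction (characteristicZero (suc n)) (#-irrefl ιi≈0)
  fromℤ-kernel -[1+ n ]    ιi≈0 = contradiction (characteristicZero (suc n))
    (#-irrefl (F.trans (F.sym (-‿involutive _)) (F.trans (F.-‿cong ιi≈0) -0#≈0#)))
    where open RingProperties F.ring using (-‿involutive; -0#≈0#)

  module _ (S : CommutativeRing c′ ℓ′) {f : F.Carrier → CommutativeRing.Carrier S}
           (f-hom : IsRingHomomorphism R (CommutativeRing.rawRing S) f)
           (x y : CommutativeRing.Carrier S) where
    private
      module S = CommutativeRing S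
      module f = IsRingHomomorphism f-hom

      inner-hom : IsRingHomomorphism (Poly R) S.rawRing (horner S.rawRing f x)
      inner-hom = horner-isRingHomomorphism S f-hom x

    substitute : RawRing.Carrier (Poly₂ R) → S.Carrier
    substitute = horner S.rawRing (horner S.rawRing f x) y

    substitute-isRingHomomorphism : IsRingHomomorphism (Poly₂ R) S.rawRing substitute
    substitute-isRingHomomorphism = horner-isRingHomomorphism S inner-hom y

    private
      module φ = IsRingHomomorphism substitute-isRingHomomorphism

      open SetoidReasoning S.setoid

      constant : ∀ {u v} → u S.≈ v → u S.+ y S.* S.0# S.≈ v
      constant u≈v = S.trans (S.+-cong u≈v (S.zeroʳ y)) (S.+-identityʳ _)

      constant′ : ∀ {u v} → u S.≈ v → u S.+ x S.* S.0# S.≈ v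
      constant′ u≈v = S.trans (S.+-cong u≈v (S.zeroʳ x)) (S.+-identityʳ _)

    substitute-α : substitute (α R) S.≈ x
    substitute-α = constant (S.trans
      (S.+-cong f.0#-homo (S.trans (S.*-congˡ (constant′ f.1#-homo)) (S.*-identityʳ x)))
      (S.+-identityˡ x))

    substitute-β : substitute (β R) S.≈ y
    substitute-β = S.trans (S.+-identityˡ _)
      (S.trans (S.*-congˡ (constant (constant′ f.1#-homo))) (S.*-identityʳ y))

    substitute-const₂ : ∀ r → substitute (const₂ R r) S.≈ f r
    substitute-const₂ r = constant (constant′ S.refl)

    substitute-Φ : ∀ d → substitute (Φ R (ζ d) d) S.≈ cyclotomic K S f-hom x y d
    substitute-Φ d = begin
      substitute (foldr P₂._*_ P₂.1# (map factor ks))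
        ≈⟨ fold ks ⟩
      foldr S._*_ S.1# (map (substitute ∘ factor) ks)
        ≈⟨ foldr-filter *-S (λ j → gcd j d ℕ.≟ 1) (substitute ∘ factor) suc d ⟩
      ∏ *-S d (λ j → when *-S (gcd (suc j) d ℕ.≟ 1) (substitute (factor (suc j))))
        ≈⟨ ∏-cong *-S d (λ j _ → when-⇔ *-S (gcd (suc j) d ℕ.≟ 1) (gcd (suc j) d ℕ.≟ 1) id id
             (λ _ → substitute-factor (suc j))) ⟩
      cyclotomic K S f-hom x y d
        ∎
      where
      *-S = S.*-commutativeMonoid
      module P₂ = RawRing (Poly₂ R)
      ks = filter (λ j → gcd j d ℕ.≟ 1) (applyUpTo suc d)
      factor : ℕ → P₂.Carrier
      factor j = α R P₂.+ (P₂.- (const₂ R (ζ d ^ j) P₂.* β R))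
      fold : ∀ ks → substitute (foldr P₂._*_ P₂.1# (map factor ks)) S.≈
                    foldr S._*_ S.1# (map (substitute ∘ factor) ks)
      fold []       = φ.1#-homo
      fold (k ∷ ks) = S.trans (φ.*-homo (factor k) (foldr P₂._*_ P₂.1# (map factor ks))) (S.*-congˡ (fold ks))
      substitute-factor : ∀ j → substitute (factor j) S.≈ x S.- f (ζ d ^ j) S.* y
      substitute-factor j = begin
        substitute (factor j)
          ≈⟨ φ.+-homo (α R) (P₂.- (const₂ R (ζ d ^ j) P₂.* β R)) ⟩
        substitute (α R) S.+ substitute (P₂.- (const₂ R (ζ d ^ j) P₂.* β R))
          ≈⟨ S.+-cong substitute-α (φ.-‿homo (const₂ R (ζ d ^ j) P₂.* β R)) ⟩
        x S.- substitute (const₂ R (ζ d ^ j) P₂.* β R)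
          ≈⟨ S.+-congˡ (S.-‿cong (φ.*-homo (const₂ R (ζ d ^ j)) (β R))) ⟩
        x S.- substitute (const₂ R (ζ d ^ j)) S.* substitute (β R)
          ≈⟨ S.+-congˡ (S.-‿cong (S.*-cong (substitute-const₂ (ζ d ^ j)) substitute-β)) ⟩
        x S.- f (ζ d ^ j) S.* y
          ∎

  module _ (P : ℕ → RawRing.Carrier ℤ[s,t]) (atoms : IsLucasAtoms K P) (s t : ℤ) where
    open QuadraticExtension commutativeRing (fromℤ R s) (fromℤ R t)
      using (embed; embed-isRingHomomorphism; X; X̄; X+X̄≈s; -XX̄≈t) renaming (extension to S)
    private
      module S = CommutativeRing S
      open SetoidReasoning S.setoid

      ι : ℤ → S.Carrier
      ι = fromℤ S.rawRing

      module ι = IsRingHomomorphism (fromℤ-isRingHomomorphism S)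

      φ : RawRing.Carrier (Poly₂ R) → S.Carrier
      φ = substitute S embed-isRingHomomorphism X X̄
      φ-hom = substitute-isRingHomomorphism S embed-isRingHomomorphism X X̄
      module φ = IsRingHomomorphism φ-hom

      embed-fromℤ : ∀ i → embed (fromℤ R i) S.≈ ι i
      embed-fromℤ = hom-fromℤ S embed-isRingHomomorphism

      -- The first coordinate of an equality in the extension is an equality in `K`, where
      -- characteristic zero applies.
      ι-injective : ∀ {i j} → ι i S.≈ ι j → i ≡ j
      ι-injective {i} {j} ιi≈ιj = ℤ.i-j≡0⇒i≡j i j (fromℤ-kernel (i ℤ.- j) (proj₁ (begin
        embed (fromℤ R (i ℤ.- j))   ≈⟨ embed-fromℤ (i ℤ.- j) ⟩
        ι (i ℤ.- j)                 ≈⟨ ι.+-homo i (ℤ.- j) ⟩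
        ι i S.+ ι (ℤ.- j)           ≈⟨ S.+-cong ιi≈ιj (ι.-‿homo j) ⟩
        ι j S.- ι j                 ≈⟨ S.-‿inverseʳ (ι j) ⟩
        S.0#                        ∎)))

      trace : X S.+ X̄ S.≈ ι s
      trace = S.trans X+X̄≈s (embed-fromℤ s)

      norm : S.- (X S.* X̄) S.≈ ι t
      norm = S.trans -XX̄≈t (embed-fromℤ t)

      -- The defining identity of the atoms at α = X and β = X̄, where α + β and -αβ become s and t.
      atom-cyclotomic : ∀ d → d ℕ.≥ 2 → ι (eval +-*-rawRing (P d) s t) S.≈ cyclotomic K S embed-isRingHomomorphism X X̄ d
      atom-cyclotomic d d≥2 = begin
        ι (eval +-*-rawRing (P d) s t)
          ≈⟨ hom-eval S (fromℤ-isRingHomomorphism S) (P d) S.refl S.refl ⟩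
        eval S.rawRing (P d) (ι s) (ι t)
          ≈⟨ hom-eval S φ-hom (P d)
               (S.trans (φ.+-homo (α R) (β R)) (S.trans (S.+-cong φα φβ) trace))
               (S.trans (φ.-‿homo (α R P₂.* β R)) (S.trans (S.-‿cong (S.trans (φ.*-homo (α R) (β R)) (S.*-cong φα φβ))) norm)) ⟨
        φ (eval (Poly₂ R) (P d) (α R P₂.+ β R) (P₂.- (α R P₂.* β R)))
          ≈⟨ φ.⟦⟧-cong {eval (Poly₂ R) (P d) (α R P₂.+ β R) (P₂.- (α R P₂.* β R))} {Φ R (ζ d) d} (proj₂ atoms d d≥2) ⟩
        φ (Φ R (ζ d) d)
          ≈⟨ substitute-Φ S embed-isRingHomomorphism X X̄ d ⟩
        cyclotomic K S embed-isRingHomomorphism X X̄ d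
          ∎
        where
        module P₂ = RawRing (Poly₂ R)
        φα = substitute-α S embed-isRingHomomorphism X X̄
        φβ = substitute-β S embed-isRingHomomorphism X X̄

    V-duplication : ∀ n → V s t (n ℕ.+ n) ≡ V s t n ℤ.* V s t n ℤ.- + 2 ℤ.* (ℤ.- t) ℤ.^ n
    V-duplication = V-double S {s} {t} trace norm ι-injective

    -- U_{mq} / U_m is the q-th term of the Lucas sequence with roots α^m and β^m.
    atoms-product : ∀ m q .{{_ : NonZero m}} .{{_ : NonZero q}} →
      U (V s t m) (ℤ.- (ℤ.- t) ℤ.^ m) q ≡
      ∏ ℤ.*-1-commutativeMonoid (m ℕ.* q) (λ i → when ℤ.*-1-commutativeMonoid
        ((suc i ∣? (m ℕ.* q)) ×-dec ¬? (suc i ∣? m)) (eval +-*-rawRing (P (suc i)) s t))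
    atoms-product m q = ι-injective (begin
      ι (U (V s t m) (ℤ.- (ℤ.- t) ℤ.^ m) q)
        ≈⟨ U-geometric S {V s t m} {ℤ.- (ℤ.- t) ℤ.^ m} (S.sym (V-powers S {s} {t} trace norm m))
             (S.trans (S.-‿cong (S.sym (norm-powers S {s} {t} trace norm m))) (S.sym (ι.-‿homo ((ℤ.- t) ℤ.^ m)))) q ⟩
      geometric S q _ _
        ≈⟨ geometric-cyclotomic K S embed-isRingHomomorphism X X̄ m q ⟩
      ∏ *-S n (λ i → when *-S (cond i) (cyclotomic K S embed-isRingHomomorphism X X̄ (suc i)))
        ≈⟨ ∏-cong *-S n (λ i _ → when-⇔ *-S (cond i) (cond i) id id (λ (_ , i∤m) →
             S.sym (atom-cyclotomic (suc i) (≥2 i i∤m)))) ⟩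
      ∏ *-S n (λ i → when *-S (cond i) (ι (eval +-*-rawRing (P (suc i)) s t)))
        ≈⟨ ∏-cong *-S n (λ i _ → when-homo *-ℤ *-S ι ι.1#-homo (cond i) (eval +-*-rawRing (P (suc i)) s t)) ⟨
      ∏ *-S n (λ i → ι (when *-ℤ (cond i) (eval +-*-rawRing (P (suc i)) s t)))
        ≈⟨ ∏-homo *-ℤ *-S ι ι.1#-homo ι.*-homo n (λ i → when *-ℤ (cond i) (eval +-*-rawRing (P (suc i)) s t)) ⟨
      ι (∏ *-ℤ n (λ i → when *-ℤ (cond i) (eval +-*-rawRing (P (suc i)) s t)))
        ∎)
      where
      *-S = S.*-commutativeMonoid
      *-ℤ = ℤ.*-1-commutativeMonoid
      n = m ℕ.* q
      cond : ∀ i → Dec (suc i ℕ.∣ n × suc i ∤ m)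
      cond i = (suc i ∣? n) ×-dec ¬? (suc i ∣? m)
      -- Since 1 divides m, the index 1 never occurs; there the atom is 1 and not α - β.
      ≥2 : ∀ i → suc i ∤ m → suc i ℕ.≥ 2
      ≥2 zero    1∤m = contradiction (ℕ.1∣ m) 1∤m
      ≥2 (suc i) _   = s≤s (s≤s z≤n)

-- The 2-adic valuation.

2∤1 : 2 ∤ 1
2∤1 = ℕ.>⇒∤ (s<s z<s)

n<2^n : ∀ n → n ℕ.< 2 ℕ.^ n
n<2^n zero    = z<s
n<2^n (suc n) = ℕ.<-≤-trans (s<s (n<2^n n)) (ℕ.+-mono-≤ (ℕ.m^n>0 2 n) (ℕ.m≤m+n (2 ℕ.^ n) 0))

∤⇒coprime-2 : ∀ {u} → 2 ∤ u → Coprime u 2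
∤⇒coprime-2 2∤u {0}                 (_   , 0∣2) = contradiction (ℕ.0∣⇒≡0 0∣2) λ ()
∤⇒coprime-2 2∤u {1}                 _           = ≡.refl
∤⇒coprime-2 2∤u {2}                 (2∣u , _)   = contradiction 2∣u 2∤u
∤⇒coprime-2 2∤u {suc (suc (suc _))} (_   , d∣2) = contradiction d∣2 (ℕ.>⇒∤ (s<s (s<s z<s)))

∣2^⇒≡1 : ∀ {u} h → 2 ∤ u → u ℕ.∣ 2 ℕ.^ h → u ≡ 1
∣2^⇒≡1 zero    2∤u u∣ = ℕ.∣1⇒≡1 u∣
∣2^⇒≡1 (suc h) 2∤u u∣ = ∣2^⇒≡1 h 2∤u (coprime-divisor (∤⇒coprime-2 2∤u) u∣)

2-part : ∀ n .{{_ : NonZero n}} → ∃[ e ] ∃[ u ] 2 ∤ u × n ≡ 2 ℕ.^ e ℕ.* u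
2-part n = <-rec (λ n → NonZero n → ∃[ e ] ∃[ u ] 2 ∤ u × n ≡ 2 ℕ.^ e ℕ.* u) step n (ℕ.≢-nonZero (ℕ.≢-nonZero⁻¹ n))
  where
  step : ∀ n → (∀ {m} → m ℕ.< n → NonZero m → ∃[ e ] ∃[ u ] 2 ∤ u × m ≡ 2 ℕ.^ e ℕ.* u) →
         NonZero n → ∃[ e ] ∃[ u ] 2 ∤ u × n ≡ 2 ℕ.^ e ℕ.* u
  step n rec n≢0 with 2 ∣? n
  ... | no 2∤n = 0 , n , 2∤n , ≡.sym (ℕ.*-identityˡ n)
  ... | yes (divides (suc k) ≡.refl) with rec (ℕ.m<m*n (suc k) 2 (s<s z<s)) _
  ...   | e , u , 2∤u , eq = suc e , u , 2∤u ,
    ≡.trans (ℕ.*-comm (suc k) 2) (≡.trans (≡.cong (2 ℕ.*_) eq) (≡.sym (ℕ.*-assoc 2 (2 ℕ.^ e) u)))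

private
  2^∤ : ∀ e k u → 2 ∤ u → e ℕ.< k → 2 ℕ.^ k ∤ 2 ℕ.^ e ℕ.* u
  2^∤ zero    (suc k) u 2∤u _         d = 2∤u (≡.subst (2 ℕ.∣_) (ℕ.*-identityˡ u) (ℕ.∣-trans (ℕ.m∣m*n (2 ℕ.^ k)) d))
  2^∤ (suc e) (suc k) u 2∤u (s<s e<k) d =
    2^∤ e k u 2∤u e<k (ℕ.*-cancelˡ-∣ 2 (≡.subst (2 ℕ.^ suc k ℕ.∣_) (ℕ.*-assoc 2 (2 ℕ.^ e) u) d))

  greatestExponent-2^* : ∀ e u k → 2 ∤ u → e ℕ.≤ k → greatestExponent (2 ℕ.^ e ℕ.* u) k ≡ e
  greatestExponent-2^* zero u zero    2∤u _   = ≡.refl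
  greatestExponent-2^* e    u (suc k) 2∤u e≤k with (2 ℕ.^ suc k) ∣? (2 ℕ.^ e ℕ.* u) | ℕ.m≤n⇒m<n∨m≡n e≤k
  ... | yes d | inj₁ e<k       = contradiction d (2^∤ e (suc k) u 2∤u e<k)
  ... | yes _ | inj₂ ≡.refl    = ≡.refl
  ... | no  _ | inj₁ (s≤s e≤k) = greatestExponent-2^* e u k 2∤u e≤k
  ... | no ¬d | inj₂ ≡.refl    = contradiction (ℕ.m∣m*n u) ¬d

-- The bounded search in `v₂ℕ` reaches the exponent because e < 2ᵉ ≤ 2ᵉ u.
v₂ℕ-2^* : ∀ e u → 2 ∤ u → v₂ℕ (2 ℕ.^ e ℕ.* u) ≡ [ e ]
v₂ℕ-2^* e u 2∤u = ≡.trans (nonZero (2 ℕ.^ e ℕ.* u))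
  (≡.cong [_] (greatestExponent-2^* e u (2 ℕ.^ e ℕ.* u) 2∤u
    (ℕ.≤-trans (ℕ.<⇒≤ (n<2^n e)) (ℕ.m≤m*n (2 ℕ.^ e) u))))
  where
  instance
    u≢0 : NonZero u
    u≢0 = ℕ.≢-nonZero (λ { ≡.refl → 2∤u (2 ℕ.∣0) })
    2^≢0 : NonZero (2 ℕ.^ e)
    2^≢0 = ℕ.m^n≢0 2 e
    *≢0 : NonZero (2 ℕ.^ e ℕ.* u)
    *≢0 = ℕ.m*n≢0 (2 ℕ.^ e) u
  nonZero : ∀ n .{{_ : NonZero n}} → v₂ℕ n ≡ [ greatestExponent n n ]
  nonZero (suc n) = ≡.refl

+⁺-identityˡ : ∀ v → [ 0 ] +⁺ v ≡ v
+⁺-identityˡ ⊤⁺    = ≡.refl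
+⁺-identityˡ [ n ] = ≡.refl

-- Exponents add because a product of odd numbers is odd. At zero `⊤⁺` absorbs the other summand,
-- which matters later because U_3 and U_6 can vanish.
v₂ℕ-* : ∀ m n → v₂ℕ (m ℕ.* n) ≡ v₂ℕ m +⁺ v₂ℕ n
v₂ℕ-* zero      n         = ≡.refl
v₂ℕ-* m@(suc _) zero      = ≡.cong v₂ℕ (ℕ.*-zeroʳ m)
v₂ℕ-* m@(suc _) n@(suc _) with 2-part m | 2-part n
... | e , u , 2∤u , m≡ | f , w , 2∤w , n≡ = begin
  v₂ℕ (m ℕ.* n)
    ≡⟨ ≡.cong v₂ℕ (≡.trans (≡.cong₂ ℕ._*_ m≡ n≡) (interchange (2 ℕ.^ e) u (2 ℕ.^ f) w)) ⟩
  v₂ℕ (2 ℕ.^ e ℕ.* 2 ℕ.^ f ℕ.* (u ℕ.* w))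
    ≡⟨ ≡.cong (λ p → v₂ℕ (p ℕ.* (u ℕ.* w))) (ℕ.^-distribˡ-+-* 2 e f) ⟨
  v₂ℕ (2 ℕ.^ (e ℕ.+ f) ℕ.* (u ℕ.* w))
    ≡⟨ v₂ℕ-2^* (e ℕ.+ f) (u ℕ.* w) ([ 2∤u , 2∤w ]′ ∘ euclidsLemma u w prime[2]) ⟩
  [ e ] +⁺ [ f ]
    ≡⟨ ≡.cong₂ _+⁺_ (≡.trans (≡.cong v₂ℕ m≡) (v₂ℕ-2^* e u 2∤u)) (≡.trans (≡.cong v₂ℕ n≡) (v₂ℕ-2^* f w 2∤w)) ⟨
  v₂ℕ m +⁺ v₂ℕ n                                   ∎
  where
  open ≡.≡-Reasoning
  open CommutativeSemigroupProperties ℕ.*-commutativeSemigroup using (interchange)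

-- Parity of integers.

Even Odd : ℤ → Set
Even x = + 2 ℤ.∣ x
Odd x = ¬ Even x

v₂-* : ∀ x y → v₂ (x ℤ.* y) ≡ v₂ x +⁺ v₂ y
v₂-* x y = ≡.trans (≡.cong v₂ℕ (ℤ.abs-* x y)) (v₂ℕ-* ℤ.∣ x ∣ ℤ.∣ y ∣)

v₂-odd : ∀ x → Odd x → v₂ x ≡ [ 0 ]
v₂-odd x odd = ≡.trans (≡.cong v₂ℕ (≡.sym (ℕ.*-identityˡ ℤ.∣ x ∣))) (v₂ℕ-2^* 0 ℤ.∣ x ∣ odd)

v₂-odd* : ∀ x y → Odd x → v₂ (x ℤ.* y) ≡ v₂ y
v₂-odd* x y odd = ≡.trans (v₂-* x y) (≡.trans (≡.cong (_+⁺ v₂ y) (v₂-odd x odd)) (+⁺-identityˡ (v₂ y)))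

even+even : ∀ x y → Even x → Even y → Even (x ℤ.+ y)
even+even x y p q = Signed.∣⇒∣ᵤ (Signed.∣m∣n⇒∣m+n {+ 2} {x} {y} (Signed.∣ᵤ⇒∣ p) (Signed.∣ᵤ⇒∣ q))

even+odd : ∀ x y → Even x → Odd y → Odd (x ℤ.+ y)
even+odd x y p q r = q (Signed.∣⇒∣ᵤ (Signed.∣m+n∣m⇒∣n {+ 2} {x} {y} (Signed.∣ᵤ⇒∣ r) (Signed.∣ᵤ⇒∣ p)))

odd+even : ∀ x y → Odd x → Even y → Odd (x ℤ.+ y)
odd+even x y p q = ≡.subst Odd (ℤ.+-comm y x) (even+odd y x q p)

even* : ∀ x y → Even x → Even (x ℤ.* y)
even* x y p = Signed.∣⇒∣ᵤ (Signed.∣m⇒∣m*n {+ 2} {x} y (Signed.∣ᵤ⇒∣ p))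

*even : ∀ x y → Even y → Even (x ℤ.* y)
*even x y p = Signed.∣⇒∣ᵤ (Signed.∣n⇒∣m*n {+ 2} x {y} (Signed.∣ᵤ⇒∣ p))

odd*odd : ∀ x y → Odd x → Odd y → Odd (x ℤ.* y)
odd*odd x y p q r = [ p , q ]′ (euclidsLemma ℤ.∣ x ∣ ℤ.∣ y ∣ prime[2] (≡.subst (2 ℕ.∣_) (ℤ.abs-* x y) r))

odd*⁻ʳ : ∀ x y → Odd (x ℤ.* y) → Odd y
odd*⁻ʳ x y odd even = odd (*even x y even)

odd-neg : ∀ x → Odd x → Odd (ℤ.- x)
odd-neg x odd even = odd (≡.subst (2 ℕ.∣_) (ℤ.∣-i∣≡∣i∣ x) even)

odd^ : ∀ x n → Odd x → Odd (x ℤ.^ n)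
odd^ x zero    p = 2∤1
odd^ x (suc n) p = odd*odd x (x ℤ.^ n) p (odd^ x n p)

even⇒2* : ∀ x → Even x → ∃[ k ] x ≡ + 2 ℤ.* k
even⇒2* x p with Signed.∣ᵤ⇒∣ {+ 2} {x} p
... | Signed.divides k x≡ = k , ≡.trans x≡ (ℤ.*-comm k (+ 2))

odd⇒1+2* : ∀ x → Odd x → ∃[ k ] x ≡ + 1 ℤ.+ + 2 ℤ.* k
odd⇒1+2* x odd with x ℤ.% + 2 | x ℤ./ + 2 | ℤ.n%d<d x (+ 2) | ℤ.a≡a%n+[a/n]*n x (+ 2)
... | 0 | k | _ | x≡ = contradiction
  (≡.subst Even (≡.sym (≡.trans x≡ (ℤ.+-identityˡ (k ℤ.* + 2)))) (*even k (+ 2) ℕ.∣-refl)) odd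
... | 1 | k | _ | x≡ = k , ≡.trans x≡ (≡.cong (λ i → + 1 ℤ.+ i) (ℤ.*-comm k (+ 2)))
... | suc (suc _) | _ | s≤s (s≤s ()) | _

odd+odd : ∀ x y → Odd x → Odd y → Even (x ℤ.+ y)
odd+odd x y p q with odd⇒1+2* x p | odd⇒1+2* y q
... | k , ≡.refl | l , ≡.refl = ≡.subst Even (lemma k l) (even* (+ 2) (+ 1 ℤ.+ k ℤ.+ l) ℕ.∣-refl)
  where
  lemma : ∀ k l → + 2 ℤ.* (+ 1 ℤ.+ k ℤ.+ l) ≡ + 1 ℤ.+ + 2 ℤ.* k ℤ.+ (+ 1 ℤ.+ + 2 ℤ.* l)
  lemma = solve-∀

v₂-2*odd : ∀ y → Odd y → v₂ (+ 2 ℤ.* y) ≡ [ 1 ]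
v₂-2*odd y odd = ≡.trans (v₂-* (+ 2) y) (≡.cong ([ 1 ] +⁺_) (v₂-odd y odd))

-- Small terms and parity of Lucas sequences.

U₂≡s : ∀ s t → U s t 2 ≡ s
U₂≡s s t = lemma s t
  where
  lemma : ∀ s t → s ℤ.* (+ 1) ℤ.+ t ℤ.* (+ 0) ≡ s
  lemma = solve-∀

U₃≡s²+t : ∀ s t → U s t 3 ≡ s ℤ.* s ℤ.+ t
U₃≡s²+t s t = lemma s t
  where
  lemma : ∀ s t → s ℤ.* (s ℤ.* (+ 1) ℤ.+ t ℤ.* (+ 0)) ℤ.+ t ℤ.* (+ 1) ≡ s ℤ.* s ℤ.+ t
  lemma = solve-∀

U₆≡V₃U₃ : ∀ s t → U s t 6 ≡ V s t 3 ℤ.* U s t 3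
U₆≡V₃U₃ s t = ≡.trans (≡.cong (λ u → W (s ℤ.* u ℤ.+ t ℤ.* U s t 2) u) (U₃≡s²+t s t))
  (≡.trans (≡.cong (λ u → W (s ℤ.* (s ℤ.* s ℤ.+ t) ℤ.+ t ℤ.* u) (s ℤ.* s ℤ.+ t)) (U₂≡s s t))
  (≡.trans (lemma s t) (≡.cong (V s t 3 ℤ.*_) (≡.sym (U₃≡s²+t s t)))))
  where
  -- `W` writes U_6 in terms of U_4 and U_3. The short forms of U_3 and U_2 are inserted before the
  -- polynomial identity is solved.
  W : ℤ → ℤ → ℤ
  W u₄ u₃ = s ℤ.* (s ℤ.* u₄ ℤ.+ t ℤ.* u₃) ℤ.+ t ℤ.* u₄
  lemma : ∀ s t → s ℤ.* (s ℤ.* (s ℤ.* (s ℤ.* s ℤ.+ t) ℤ.+ t ℤ.* s) ℤ.+ t ℤ.* (s ℤ.* s ℤ.+ t))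
                    ℤ.+ t ℤ.* (s ℤ.* (s ℤ.* s ℤ.+ t) ℤ.+ t ℤ.* s)
                  ≡ (s ℤ.* (s ℤ.* s ℤ.+ t ℤ.* + 2) ℤ.+ t ℤ.* s) ℤ.* (s ℤ.* s ℤ.+ t)
  lemma = solve-∀

module _ (s t : ℤ) (s-even : Even s) where

  V-even : ∀ n → Even (V s t n)
  V-even 0             = ℕ.∣-refl
  V-even 1             = s-even
  V-even (suc (suc n)) = even+even (s ℤ.* V s t (suc n)) (t ℤ.* V s t n)
    (even* s (V s t (suc n)) s-even) (*even t (V s t n) (V-even n))

  -- Modulo 2 the recurrence reads U_{n+2} = t U_n. It will be applied to the sequence with roots xᵐ
  -- and yᵐ, whose parameters V_m and -(-t)ᵐ take the places of s and t.
  U-odd : Odd t → ∀ n → 2 ∤ n → Odd (U s t n)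
  U-odd t-odd 0             2∤n = contradiction (2 ℕ.∣0) 2∤n
  U-odd t-odd 1             _   = 2∤1
  U-odd t-odd (suc (suc n)) 2∤n = even+odd (s ℤ.* U s t (suc n)) (t ℤ.* U s t n)
    (even* s (U s t (suc n)) s-even)
    (odd*odd t (U s t n) t-odd (U-odd t-odd n (2∤n ∘ ℕ.∣m∣n⇒∣m+n ℕ.∣-refl)))

-- U and V have period 3 modulo 2.
module _ (s t : ℤ) (s-odd : Odd s) (t-odd : Odd t) where

  private
    -- In three steps of the recurrence the older term y gets the odd coefficient st and the newer
    -- term x the even coefficient s² + t, which explains the period.
    three-steps : ∀ x y → s ℤ.* (s ℤ.* x ℤ.+ t ℤ.* y) ℤ.+ t ℤ.* x ≡ (s ℤ.* s ℤ.+ t) ℤ.* x ℤ.+ s ℤ.* t ℤ.* y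
    three-steps = lemma s t
      where
      lemma : ∀ s t x y → s ℤ.* (s ℤ.* x ℤ.+ t ℤ.* y) ℤ.+ t ℤ.* x ≡ (s ℤ.* s ℤ.+ t) ℤ.* x ℤ.+ s ℤ.* t ℤ.* y
      lemma = solve-∀

    s²+t-even : ∀ x → Even ((s ℤ.* s ℤ.+ t) ℤ.* x)
    s²+t-even x = even* (s ℤ.* s ℤ.+ t) x (odd+odd (s ℤ.* s) t (odd*odd s s s-odd s-odd) t-odd)

  V-even-3∣ : ∀ k → Even (V s t (k ℕ.* 3))
  V-even-3∣ zero    = ℕ.∣-refl
  V-even-3∣ (suc k) = ≡.subst Even (≡.sym (three-steps x y))
    (even+even ((s ℤ.* s ℤ.+ t) ℤ.* x) (s ℤ.* t ℤ.* y) (s²+t-even x) (*even (s ℤ.* t) y (V-even-3∣ k)))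
    where
    x = V s t (suc (k ℕ.* 3))
    y = V s t (k ℕ.* 3)

  U-odd-3∤ : ∀ n → 3 ∤ n → Odd (U s t n)
  U-odd-3∤ 0                   3∤n = contradiction (3 ℕ.∣0) 3∤n
  U-odd-3∤ 1                   _   = 2∤1
  U-odd-3∤ 2                   _   = ≡.subst Odd (≡.sym (U₂≡s s t)) s-odd
  U-odd-3∤ (suc (suc (suc n))) 3∤n = ≡.subst Odd (≡.sym (three-steps x y))
    (even+odd ((s ℤ.* s ℤ.+ t) ℤ.* x) (s ℤ.* t ℤ.* y) (s²+t-even x)
      (odd*odd (s ℤ.* t) y (odd*odd s t s-odd t-odd) (U-odd-3∤ n (3∤n ∘ ℕ.∣m∣n⇒∣m+n ℕ.∣-refl))))
    where
    x = U s t (suc n)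
    y = U s t n

-- Valuations of the atoms.

open import Data.Integer.Divisibility using (_∣_)
open import Data.Nat.Base using (_*_; _^_; _≥_)

private
  *-ℤ = ℤ.*-1-commutativeMonoid

∏-odd : ∀ n (f : ℕ → ℤ) → (∀ i → i ℕ.< n → Odd (f i)) → Odd (∏ *-ℤ n f)
∏-odd zero    f odd = 2∤1
∏-odd (suc n) f odd = odd*odd (f 0) (∏ *-ℤ n (f ∘ suc)) (odd 0 z<s) (∏-odd n (f ∘ suc) (λ i i<n → odd (suc i) (s<s i<n)))

when-odd : {A : Set p} (A? : Dec A) (x : ℤ) → (A → Odd x) → Odd (when *-ℤ A? x)
when-odd (yes a) x odd = odd a
when-odd (no _)  x odd = 2∤1

-- An even cofactor 2l would give m = ld. So d contains the full power of 2 in 2m.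
odd-cofactor : ∀ {d m} → d ℕ.∣ 2 * m → d ∤ m → ∃[ k ] 2 ∤ k × 2 * m ≡ k * d
odd-cofactor {d} {m} (divides k n≡kd) d∤m = k , 2∤k , n≡kd
  where
  2∤k : 2 ∤ k
  2∤k (divides l ≡.refl) = d∤m (divides l (ℕ.*-cancelˡ-≡ m (l * d) 2
    (≡.trans n≡kd (≡.trans (≡.cong (_* d) (ℕ.*-comm l 2)) (ℕ.*-assoc 2 l d)))))

odd≢1⇒≥2 : ∀ {u} → 2 ∤ u → u ≢ 1 → u ≥ 2
odd≢1⇒≥2 {0}           2∤u _   = contradiction (2 ℕ.∣0) 2∤u
odd≢1⇒≥2 {1}           _   u≢1 = contradiction ≡.refl u≢1
odd≢1⇒≥2 {suc (suc _)} _   _   = s≤s (s≤s z≤n)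

module _ (K : FieldWithRootsOfUnity c ℓ₁ ℓ₂) (P : ℕ → RawRing.Carrier ℤ[s,t])
         (atoms : IsLucasAtoms K P) (s t : ℤ) where
  private
    p⟨_⟩ : ℕ → ℤ
    p⟨ n ⟩ = eval +-*-rawRing (P n) s t

    norm^ : ℕ → ℤ
    norm^ m = ℤ.- (ℤ.- t) ℤ.^ m

    norm^-odd : Odd t → ∀ m → Odd (norm^ m)
    norm^-odd t-odd m = odd-neg ((ℤ.- t) ℤ.^ m) (odd^ (ℤ.- t) m (odd-neg t t-odd))

  atom-1 : p⟨ 1 ⟩ ≡ + 1
  atom-1 = ≡.trans (⟦⟧-cong {P 1} {RawRing.1# ℤ[s,t]} (proj₁ atoms)) 1#-homo
    where
    open IsRingHomomorphism (horner-isRingHomomorphism ℤ.+-*-commutativeRing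
      (horner-isRingHomomorphism ℤ.+-*-commutativeRing (fromℤ-isRingHomomorphism ℤ.+-*-commutativeRing) s) t)

  atom-1-odd : Odd p⟨ 1 ⟩
  atom-1-odd = ≡.subst Odd (≡.sym atom-1) 2∤1

  -- These d are the indices in `atoms-product` other than n itself.
  OtherAtomsOdd : ℕ → ℕ → Set
  OtherAtomsOdd m n = ∀ d → d ℕ.∣ n → d ∤ m → d ℕ.< n → Odd p⟨ d ⟩

  -- P_n is the last factor in `atoms-product`; it is present because n does not divide m when q ≥
  -- 2. The product of the other factors is the cofactor, so nothing is divided and the values may
  -- be zero.
  atom-cofactor : ∀ m q .{{_ : NonZero m}} → q ≥ 2 →
    ∃[ k ] U (V s t m) (norm^ m) q ≡ k ℤ.* p⟨ m * q ⟩ × (OtherAtomsOdd m (m * q) → Odd k)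
  atom-cofactor m q q≥2 = ∏ *-ℤ (ℕ.pred n) f , product , odd
    where
    n = m * q
    instance
      q≢0 : NonZero q
      q≢0 = ℕ.>-nonZero (ℕ.≤-trans (s≤s z≤n) q≥2)
      n≢0 : NonZero n
      n≢0 = ℕ.m*n≢0 m q
    f : ℕ → ℤ
    f i = when *-ℤ ((suc i ∣? n) ×-dec ¬? (suc i ∣? m)) p⟨ suc i ⟩
    suc-pred : suc (ℕ.pred n) ≡ n
    suc-pred = ℕ.suc-pred n
    last : f (ℕ.pred n) ≡ p⟨ n ⟩
    last = ≡.trans (when-true *-ℤ ((suc (ℕ.pred n) ∣? n) ×-dec ¬? (suc (ℕ.pred n) ∣? m))
      (≡.subst (λ k → k ℕ.∣ n × k ∤ m) (≡.sym suc-pred) (ℕ.∣-refl , ℕ.>⇒∤ (ℕ.m<m*n m q q≥2))))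
      (≡.cong p⟨_⟩ suc-pred)
    product : U (V s t m) (norm^ m) q ≡ ∏ *-ℤ (ℕ.pred n) f ℤ.* p⟨ n ⟩
    product = begin
      U (V s t m) (norm^ m) q               ≡⟨ atoms-product K P atoms s t m q ⟩
      ∏ *-ℤ n f                             ≡⟨ ≡.cong (λ k → ∏ *-ℤ k f) suc-pred ⟨
      ∏ *-ℤ (suc (ℕ.pred n)) f              ≡⟨ ∏-last *-ℤ (ℕ.pred n) f ⟩
      ∏ *-ℤ (ℕ.pred n) f ℤ.* f (ℕ.pred n)   ≡⟨ ≡.cong (∏ *-ℤ (ℕ.pred n) f ℤ.*_) last ⟩
      ∏ *-ℤ (ℕ.pred n) f ℤ.* p⟨ n ⟩         ∎
      where open ≡.≡-Reasoning
    odd : OtherAtomsOdd m n → Odd (∏ *-ℤ (ℕ.pred n) f)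
    odd others = ∏-odd (ℕ.pred n) f (λ i i<pred → when-odd ((suc i ∣? n) ×-dec ¬? (suc i ∣? m)) p⟨ suc i ⟩
      (λ (i∣n , i∤m) → others (suc i) i∣n i∤m (≡.subst (suc i ℕ.<_) suc-pred (s<s i<pred))))

  atom-odd : ∀ m q .{{_ : NonZero m}} → q ≥ 2 → Odd (U (V s t m) (norm^ m) q) → Odd p⟨ m * q ⟩
  atom-odd m q q≥2 odd =
    let k , product , _ = atom-cofactor m q q≥2
    in odd*⁻ʳ k p⟨ m * q ⟩ (≡.subst Odd product odd)

  v₂-atom : ∀ m q .{{_ : NonZero m}} → q ≥ 2 → OtherAtomsOdd m (m * q) →
            v₂ p⟨ m * q ⟩ ≡ v₂ (U (V s t m) (norm^ m) q)
  v₂-atom m q q≥2 others =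
    let k , product , odd = atom-cofactor m q q≥2
    in ≡.sym (≡.trans (≡.cong v₂ product) (v₂-odd* k p⟨ m * q ⟩ (odd others)))

  v₂-atom-double : ∀ m .{{_ : NonZero m}} → OtherAtomsOdd m (2 * m) → v₂ p⟨ 2 * m ⟩ ≡ v₂ (V s t m)
  v₂-atom-double m others = ≡.subst (λ n → OtherAtomsOdd m n → v₂ p⟨ n ⟩ ≡ v₂ (V s t m)) (ℕ.*-comm m 2)
    (λ others → ≡.trans (v₂-atom m 2 ℕ.≤-refl others) (≡.cong v₂ (U₂≡s (V s t m) (norm^ m)))) others

  v₂-V-double : Odd t → ∀ n → Even (V s t n) → v₂ (V s t (2 * n)) ≡ [ 1 ]
  v₂-V-double t-odd n Vₙ-even = begin
    v₂ (V s t (2 * n))                                    ≡⟨ ≡.cong (v₂ ∘ V s t ∘ (n ℕ.+_)) (ℕ.+-identityʳ n) ⟩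
    v₂ (V s t (n ℕ.+ n))                                  ≡⟨ ≡.cong v₂ (V-duplication K P atoms s t n) ⟩
    v₂ (V s t n ℤ.* V s t n ℤ.- + 2 ℤ.* N)                ≡⟨ ≡.cong (λ v → v₂ (v ℤ.* v ℤ.- + 2 ℤ.* N)) Vₙ≡2k ⟩
    v₂ (+ 2 ℤ.* k ℤ.* (+ 2 ℤ.* k) ℤ.- + 2 ℤ.* N)          ≡⟨ ≡.cong v₂ (lemma k N) ⟩
    v₂ (+ 2 ℤ.* (+ 2 ℤ.* (k ℤ.* k) ℤ.- N))                ≡⟨ v₂-2*odd (+ 2 ℤ.* (k ℤ.* k) ℤ.- N)
                                                              (even+odd (+ 2 ℤ.* (k ℤ.* k)) (ℤ.- N)
                                                                (even* (+ 2) (k ℤ.* k) ℕ.∣-refl) (norm^-odd t-odd n)) ⟩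
    [ 1 ]                                                 ∎
    where
    open ≡.≡-Reasoning
    N = (ℤ.- t) ℤ.^ n
    k = proj₁ (even⇒2* (V s t n) Vₙ-even)
    Vₙ≡2k = proj₂ (even⇒2* (V s t n) Vₙ-even)
    lemma : ∀ k N → + 2 ℤ.* k ℤ.* (+ 2 ℤ.* k) ℤ.- + 2 ℤ.* N ≡ + 2 ℤ.* (+ 2 ℤ.* (k ℤ.* k) ℤ.- N)
    lemma = solve-∀

  module _ (s-even : Even s) (t-odd : Odd t) where

    v₂-atom-2^ : ∀ h → v₂ p⟨ 2 ^ suc h ⟩ ≡ v₂ (V s t (2 ^ h))
    v₂-atom-2^ h = v₂-atom-double (2 ^ h) {{ℕ.m^n≢0 2 h}} others-odd
      where
      -- The condition is vacuous: the only divisor of 2^(h+1) that does not divide 2^h is 2^(h+1).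
      others-odd : OtherAtomsOdd (2 ^ h) (2 ^ suc h)
      others-odd d d∣n d∤m d<n =
        let k , 2∤k , n≡kd = odd-cofactor d∣n d∤m
            k≡1 = ∣2^⇒≡1 (suc h) 2∤k (divides d (≡.trans n≡kd (ℕ.*-comm k d)))
        in contradiction (≡.trans n≡kd (≡.trans (≡.cong (_* d) k≡1) (ℕ.*-identityˡ d))) (ℕ.>⇒≢ d<n)

    -- For m = 2^e the term V_m is even and -(-t)ᵐ is odd, so the sequence with roots xᵐ and yᵐ is
    -- again of the type in case (i), and its term of odd index u is odd.
    atom-odd-2^* : ∀ e u → 2 ∤ u → u ≢ 1 → Odd p⟨ 2 ^ e * u ⟩
    atom-odd-2^* e u 2∤u u≢1 = atom-odd (2 ^ e) u {{ℕ.m^n≢0 2 e}} (odd≢1⇒≥2 2∤u u≢1)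
      (U-odd (V s t (2 ^ e)) (norm^ (2 ^ e)) (V-even s t s-even (2 ^ e)) (norm^-odd t-odd (2 ^ e)) u 2∤u)

    atom-odd-i : ∀ n → n ≥ 1 → n ≢ 2 → ¬ (∃[ h ] (h ≥ 2 × n ≡ 2 ^ h)) → Odd p⟨ n ⟩
    atom-odd-i n n≥1 n≢2 n≢2^h with 2-part n {{ℕ.>-nonZero n≥1}}
    ... | e , u , 2∤u , n≡ with u ℕ.≟ 1
    ...   | no u≢1     = ≡.subst (λ n → Odd p⟨ n ⟩) (≡.sym n≡) (atom-odd-2^* e u 2∤u u≢1)
    ...   | yes ≡.refl = power e (≡.trans n≡ (ℕ.*-identityʳ (2 ^ e)))
      where
      power : ∀ e → n ≡ 2 ^ e → Odd p⟨ n ⟩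
      power 0             n≡1 = ≡.subst (λ n → Odd p⟨ n ⟩) (≡.sym n≡1) atom-1-odd
      power 1             n≡2 = contradiction n≡2 n≢2
      power (suc (suc e)) n≡  = contradiction (suc (suc e) , s≤s (s≤s z≤n) , n≡) n≢2^h

  module _ (s-odd : Odd s) (t-odd : Odd t) where

    -- With m = 1 the quotient is the whole term U_n, which is odd by the period 3 modulo 2.
    atom-odd-3∤ : ∀ n → 3 ∤ n → Odd p⟨ n ⟩
    atom-odd-3∤ 0               3∤n = contradiction (3 ℕ.∣0) 3∤n
    atom-odd-3∤ 1               3∤n = atom-1-odd
    atom-odd-3∤ n@(suc (suc _)) 3∤n = ≡.subst (λ n → Odd p⟨ n ⟩) (ℕ.*-identityˡ n)
      (atom-odd 1 n (s≤s (s≤s z≤n)) (U-odd-3∤ s (norm^ 1) s-odd (norm^-odd t-odd 1) n 3∤n))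

    v₂-atom-6*2^ : ∀ h → v₂ p⟨ 2 * (3 * 2 ^ h) ⟩ ≡ v₂ (V s t (3 * 2 ^ h))
    v₂-atom-6*2^ h = v₂-atom-double (3 * 2 ^ h) {{ℕ.m*n≢0 3 (2 ^ h) {{_}} {{ℕ.m^n≢0 2 h}}}} others-odd
      where
      -- A divisor prime to 3 has an odd atom. A divisor 3e that does not divide 3·2^h has an odd
      -- cofactor, which divides 2^(h+1) and hence is 1; so it is the full index.
      others-odd : OtherAtomsOdd (3 * 2 ^ h) (2 * (3 * 2 ^ h))
      others-odd d d∣n d∤m d<n with 3 ∣? d
      ... | no 3∤d = atom-odd-3∤ d 3∤d
      ... | yes (divides e d≡e*3) =
        let k , 2∤k , n≡kd = odd-cofactor d∣n d∤m
            2^≡ke : 2 ^ suc h ≡ k * e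
            2^≡ke = ℕ.*-cancelʳ-≡ (2 ^ suc h) (k * e) 3 (begin
              2 * 2 ^ h * 3      ≡⟨ ℕ.*-assoc 2 (2 ^ h) 3 ⟩
              2 * (2 ^ h * 3)    ≡⟨ ≡.cong (2 *_) (ℕ.*-comm (2 ^ h) 3) ⟩
              2 * (3 * 2 ^ h)    ≡⟨ n≡kd ⟩
              k * d              ≡⟨ ≡.cong (k *_) d≡e*3 ⟩
              k * (e * 3)        ≡⟨ ℕ.*-assoc k e 3 ⟨
              k * e * 3          ∎)
            k≡1 = ∣2^⇒≡1 (suc h) 2∤k (divides e (≡.trans 2^≡ke (ℕ.*-comm k e)))
        in contradiction (≡.trans n≡kd (≡.trans (≡.cong (_* d) k≡1) (ℕ.*-identityˡ d))) (ℕ.>⇒≢ d<n)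
        where open ≡.≡-Reasoning

    V-even-3*2^ : ∀ h → Even (V s t (3 * 2 ^ h))
    V-even-3*2^ h = ≡.subst (Even ∘ V s t) (ℕ.*-comm (2 ^ h) 3) (V-even-3∣ s t s-odd t-odd (2 ^ h))

    -- Although s is odd, V_m is even for m = 3·2^e, so the parity argument of case (i) applies to
    -- the roots xᵐ and yᵐ.
    atom-odd-3*2^* : ∀ e u → 2 ∤ u → u ≢ 1 → Odd p⟨ 3 * 2 ^ e * u ⟩
    atom-odd-3*2^* e u 2∤u u≢1 =
      atom-odd (3 * 2 ^ e) u {{ℕ.m*n≢0 3 (2 ^ e) {{_}} {{ℕ.m^n≢0 2 e}}}} (odd≢1⇒≥2 2∤u u≢1)
        (U-odd (V s t (3 * 2 ^ e)) (norm^ (3 * 2 ^ e)) (V-even-3*2^ e) (norm^-odd t-odd (3 * 2 ^ e)) u 2∤u)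

    v₂-atom-3 : v₂ p⟨ 3 ⟩ ≡ v₂ (U s t 3)
    v₂-atom-3 = ≡.trans (v₂-atom 1 3 (s≤s (s≤s z≤n)) others-odd) (≡.cong (λ t → v₂ (U s t 3)) -[-t]^1≡t)
      where
      others-odd : OtherAtomsOdd 1 3
      others-odd d d∣3 _ d<3 = atom-odd-3∤ d (λ 3∣d → ℕ.<⇒≢ d<3 (ℕ.∣-antisym d∣3 3∣d))
      -[-t]^1≡t : norm^ 1 ≡ t
      -[-t]^1≡t = ≡.trans (≡.cong ℤ.-_ (ℤ.*-identityʳ (ℤ.- t))) (ℤ.neg-involutive t)

    atom-odd-ii : ∀ n → n ≥ 1 → n ≢ 3 → n ≢ 6 → ¬ (∃[ h ] (h ≥ 2 × n ≡ 3 * 2 ^ h)) → Odd p⟨ n ⟩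
    atom-odd-ii n n≥1 n≢3 n≢6 n≢3*2^h with 3 ∣? n
    ... | no 3∤n               = atom-odd-3∤ n 3∤n
    ... | yes (divides m n≡m*3) = multiple (2-part m {{m≢0}})
      where
      m≢0 : NonZero m
      m≢0 = ℕ.≢-nonZero (λ m≡0 → ℕ.>⇒≢ n≥1 (≡.trans n≡m*3 (≡.cong (_* 3) m≡0)))
      multiple : ∃[ e ] ∃[ u ] 2 ∤ u × m ≡ 2 ^ e * u → Odd p⟨ n ⟩
      multiple (e , u , 2∤u , m≡) with u ℕ.≟ 1
      ... | no u≢1 = ≡.subst (λ n → Odd p⟨ n ⟩) (begin
        3 * 2 ^ e * u      ≡⟨ ℕ.*-assoc 3 (2 ^ e) u ⟩
        3 * (2 ^ e * u)    ≡⟨ ≡.cong (3 *_) m≡ ⟨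
        3 * m              ≡⟨ ℕ.*-comm 3 m ⟩
        m * 3              ≡⟨ n≡m*3 ⟨
        n                  ∎) (atom-odd-3*2^* e u 2∤u u≢1)
        where open ≡.≡-Reasoning
      ... | yes ≡.refl = contradiction (begin
        n                  ≡⟨ n≡m*3 ⟩
        m * 3              ≡⟨ ℕ.*-comm m 3 ⟩
        3 * m              ≡⟨ ≡.cong (3 *_) (≡.trans m≡ (ℕ.*-identityʳ (2 ^ e))) ⟩
        3 * 2 ^ e          ∎) (power e)
        where
        open ≡.≡-Reasoning
        power : ∀ e → n ≢ 3 * 2 ^ e
        power 0             = n≢3
        power 1             = n≢6
        power (suc (suc e)) n≡ = n≢3*2^h (suc (suc e) , s≤s (s≤s z≤n) , n≡)

-- Discriminant and rank of appearance of 2.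

4t-even : ∀ t → Even (+ 4 ℤ.* t)
4t-even t = even* (+ 4) t (divides 2 ≡.refl)

rank-2 : ∀ s t → Even s ⇔ (Even (Δ s t) × IsRank (+ 2) (U s t) 2)
rank-2 s t = mk⇔ to from
  where
  to : Even s → Even (Δ s t) × IsRank (+ 2) (U s t) 2
  to s-even = even+even (s ℤ.* s) (+ 4 ℤ.* t) (even* s s s-even) (4t-even t) ,
    z<s , ≡.subst Even (≡.sym (U₂≡s s t)) s-even , minimal
    where
    minimal : ∀ j → 0 ℕ.< j → Even (U s t j) → 2 ℕ.≤ j
    minimal 1             _ 2∣1 = contradiction 2∣1 2∤1
    minimal (suc (suc j)) _ _   = s≤s (s≤s z≤n)
  from : Even (Δ s t) × IsRank (+ 2) (U s t) 2 → Even s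
  from (_ , _ , U₂-even , _) = ≡.subst Even (U₂≡s s t) U₂-even

-- Modulo 2, Δ is s², and the first terms are U_1 = 1, U_2 = s and U_3 = s² + t. For odd s the term
-- U_3 is even exactly when t is odd.
rank-3 : ∀ s t → (Odd t × Odd s) ⇔ (Odd (Δ s t) × IsRank (+ 2) (U s t) 3)
rank-3 s t = mk⇔ to from
  where
  to : Odd t × Odd s → Odd (Δ s t) × IsRank (+ 2) (U s t) 3
  to (t-odd , s-odd) = odd+even (s ℤ.* s) (+ 4 ℤ.* t) (odd*odd s s s-odd s-odd) (4t-even t) ,
    z<s , ≡.subst Even (≡.sym (U₃≡s²+t s t)) (odd+odd (s ℤ.* s) t (odd*odd s s s-odd s-odd) t-odd) , minimal
    where
    minimal : ∀ j → 0 ℕ.< j → Even (U s t j) → 3 ℕ.≤ j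
    minimal 1                   _ 2∣1     = contradiction 2∣1 2∤1
    minimal 2                   _ U₂-even = contradiction (≡.subst Even (U₂≡s s t) U₂-even) s-odd
    minimal (suc (suc (suc j))) _ _       = s≤s (s≤s (s≤s z≤n))
  from : Odd (Δ s t) × IsRank (+ 2) (U s t) 3 → Odd t × Odd s
  from (Δ-odd , _ , U₃-even , _) = t-odd , s-odd
    where
    s-odd : Odd s
    s-odd s-even = Δ-odd (even+even (s ℤ.* s) (+ 4 ℤ.* t) (even* s s s-even) (4t-even t))
    t-odd : Odd t
    t-odd t-even = odd+even (s ℤ.* s) t (odd*odd s s s-odd s-odd) t-even (≡.subst Even (U₃≡s²+t s t) U₃-even)

theorem15 : ∀ {c ℓ₁ ℓ₂ : Level} (K : FieldWithRootsOfUnity c ℓ₁ ℓ₂)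
  (P : ℕ → RawRing.Carrier ℤ[s,t]) → IsLucasAtoms K P →
  (s t : ℤ) →
  let Pₛₜ = λ (n : ℕ) → eval +-*-rawRing (P n) s t
      Uₛₜ = U s t
  in
    ((¬ ((+ 2) ∣ t) → (((+ 2) ∣ s) ⇔ (((+ 2) ∣ Δ s t) × IsRank (+ 2) Uₛₜ 2))) ×
     (¬ ((+ 2) ∣ t) → (+ 2) ∣ s → (n : ℕ) → n ≥ 1 →
        (n ≡ 2 → v₂ (Pₛₜ n) ≡ v₂ (Uₛₜ 2)) ×
        ((h : ℕ) → h ≥ 2 → n ≡ 2 ^ h → v₂ (Pₛₜ n) ≡ [ 1 ]) ×
        (n ≢ 2 → ¬ (∃[ h ] (h ≥ 2 × n ≡ 2 ^ h)) → v₂ (Pₛₜ n) ≡ [ 0 ])))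
    ×
    (((¬ ((+ 2) ∣ t) × ¬ ((+ 2) ∣ s)) ⇔ (¬ ((+ 2) ∣ Δ s t) × IsRank (+ 2) Uₛₜ 3)) ×
     (¬ ((+ 2) ∣ t) → ¬ ((+ 2) ∣ s) → (n : ℕ) → n ≥ 1 →
        (n ≡ 3 → v₂ (Pₛₜ n) ≡ v₂ (Uₛₜ 3)) ×
        (n ≡ 6 → v₂ (Pₛₜ n) +⁺ v₂ (Uₛₜ 3) ≡ v₂ (Uₛₜ 6)) ×
        ((h : ℕ) → h ≥ 2 → n ≡ 3 * 2 ^ h → v₂ (Pₛₜ n) ≡ [ 1 ]) ×
        (n ≢ 3 → n ≢ 6 → ¬ (∃[ h ] (h ≥ 2 × n ≡ 3 * 2 ^ h)) → v₂ (Pₛₜ n) ≡ [ 0 ])))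
theorem15 K P atoms s t =
  ( (λ _ → rank-2 s t)
  , λ t-odd s-even n n≥1 →
      (λ { ≡.refl → ≡.trans (v₂-atom-2^ K P atoms s t s-even t-odd 0) (≡.cong v₂ (≡.sym (U₂≡s s t))) })
    , (λ { (suc (suc h)) (s≤s (s≤s z≤n)) ≡.refl →
           ≡.trans (v₂-atom-2^ K P atoms s t s-even t-odd (suc h))
                   (v₂-V-double K P atoms s t t-odd (2 ^ h) (V-even s t s-even (2 ^ h))) })
    , λ n≢2 n≢2^h → v₂-odd (Pₛₜ n) (atom-odd-i K P atoms s t s-even t-odd n n≥1 n≢2 n≢2^h) )
  , ( rank-3 s t
    , λ t-odd s-odd n n≥1 →
        (λ { ≡.refl → v₂-atom-3 K P atoms s t s-odd t-odd })
      , (λ { ≡.refl → sixth s-odd t-odd })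
      , (λ { (suc (suc h)) (s≤s (s≤s z≤n)) ≡.refl → power s-odd t-odd h })
      , λ n≢3 n≢6 n≢3*2^h → v₂-odd (Pₛₜ n) (atom-odd-ii K P atoms s t s-odd t-odd n n≥1 n≢3 n≢6 n≢3*2^h) )
  where
  Pₛₜ : ℕ → ℤ
  Pₛₜ n = eval +-*-rawRing (P n) s t
  swap : ∀ x → 3 * (2 * x) ≡ 2 * (3 * x)
  swap x = ≡.trans (≡.sym (ℕ.*-assoc 3 2 x)) (ℕ.*-assoc 2 3 x)
  -- P_6 has the valuation of V_3, and U_6 = V_3 U_3. The additive form remains true when U_3 = 0.
  sixth : Odd s → Odd t → v₂ (Pₛₜ 6) +⁺ v₂ (U s t 3) ≡ v₂ (U s t 6)
  sixth s-odd t-odd = begin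
    v₂ (Pₛₜ 6) +⁺ v₂ (U s t 3)     ≡⟨ ≡.cong (_+⁺ v₂ (U s t 3)) (v₂-atom-6*2^ K P atoms s t s-odd t-odd 0) ⟩
    v₂ (V s t 3) +⁺ v₂ (U s t 3)   ≡⟨ v₂-* (V s t 3) (U s t 3) ⟨
    v₂ (V s t 3 ℤ.* U s t 3)       ≡⟨ ≡.cong v₂ (U₆≡V₃U₃ s t) ⟨
    v₂ (U s t 6)                   ∎
    where open ≡.≡-Reasoning
  power : Odd s → Odd t → ∀ h → v₂ (Pₛₜ (3 * 2 ^ suc (suc h))) ≡ [ 1 ]
  power s-odd t-odd h = begin
    v₂ (Pₛₜ (3 * 2 ^ suc (suc h)))       ≡⟨ ≡.cong (v₂ ∘ Pₛₜ) (swap (2 ^ suc h)) ⟩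
    v₂ (Pₛₜ (2 * (3 * 2 ^ suc h)))       ≡⟨ v₂-atom-6*2^ K P atoms s t s-odd t-odd (suc h) ⟩
    v₂ (V s t (3 * 2 ^ suc h))           ≡⟨ ≡.cong (v₂ ∘ V s t) (swap (2 ^ h)) ⟩
    v₂ (V s t (2 * (3 * 2 ^ h)))
      ≡⟨ v₂-V-double K P atoms s t t-odd (3 * 2 ^ h) (V-even-3*2^ K P atoms s t s-odd t-odd h) ⟩
    [ 1 ]                                ∎
    where open ≡.≡-Reasoning
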